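{- Let $q$ be a prime power and let $\mathcal{L}$ be a non-empty set of lines of $\mathrm{PG}(n,q)$ satisfying (Pt), (Pl), (Sd) and (To). Then $\mathcal{L}$ is contained in a $6$-dimensional subspace of $\mathrm{PG}(n,q)$.
   Context: Conditions: (Pt) every point of $\mathrm{PG}(n,q)$ lies on either $0$ or $q+1$ lines of $\mathcal{L}$; (Pl) every plane contains $0$, $1$ or $q+1$ lines of $\mathcal{L}$; (Sd) every solid ($3$-dimensional subspace) contains $0$, $1$, $q+1$ or $2q+1$ lines of $\mathcal{L}$; (To) $|\mathcal{L}|\le q^5+q^4+q^3+q^2+q+1$. "Contained in a subspace" means every line of $\mathcal{L}$ lies in that subspace. -}

module Defs where

open import Level using (Level; _⊔_; suc)
open import Data.Nat as ℕ using (ℕ; zero; _≤_; _<_; _^_)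
import Data.Nat as N
open import Data.Nat.Primality using (Prime)
open import Data.Fin using (Fin) renaming (zero to fzero; suc to fsuc)
open import Data.List using (List; []; _∷_; length)
open import Data.List.Membership.Propositional using (_∈_)
open import Data.List.Relation.Unary.AllPairs using (AllPairs)
open import Data.Product using (Σ; ∃; ∃-syntax; _×_; _,_)
open import Data.Sum using (_⊎_)
open import Relation.Nullary using (¬_)
open import Relation.Binary.PropositionalEquality using (_≡_)
open import Algebra.Bundles using (CommutativeRing)

record Field c ℓ : Set (Level.suc (c ⊔ ℓ)) where
  field
    commutativeRing : CommutativeRing c ℓ
  open CommutativeRing commutativeRing public
  field
    0≉1     : ¬ (0# ≈ 1#)
    inverse : ∀ x → ¬ (x ≈ 0#) → ∃[ y ] (x * y ≈ 1#)

IsPrimePower : ℕ → Set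
IsPrimePower q = ∃[ p ] ∃[ k ] (Prime p × 1 ≤ k × q ≡ p ^ k)

HasOrder : ∀ {c ℓ} → Field c ℓ → ℕ → Set (c ⊔ ℓ)
HasOrder F q =
  Σ (Fin q → Carrier) λ e →
    (∀ i j → e i ≈ e j → i ≡ j) × (∀ x → ∃[ i ] (e i ≈ x))
  where open Field F

-- The vector space V = F^(n+1) underlying PG(n,q), and its subspaces.
-- A vector subspace of dimension d (projective dimension d-1) is
-- represented by a basis: a linearly independent family of d vectors;
-- the subspace itself is the span of the basis.

module Geometry {c ℓ} (F : Field c ℓ) (n : ℕ) where
  open Field F

  Vector : Set c
  Vector = Fin (N.suc n) → Carrier

  _≈ᵥ_ : Vector → Vector → Set ℓ
  u ≈ᵥ v = ∀ i → u i ≈ v i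

  0ᵥ : Vector
  0ᵥ _ = 0#

  _+ᵥ_ : Vector → Vector → Vector
  (u +ᵥ v) i = u i + v i

  _·ᵥ_ : Carrier → Vector → Vector
  (a ·ᵥ v) i = a * v i

  lincomb : ∀ {d} → (Fin d → Carrier) → (Fin d → Vector) → Vector
  lincomb {zero}    a b = 0ᵥ
  lincomb {N.suc d} a b = (a fzero ·ᵥ b fzero) +ᵥ lincomb (λ i → a (fsuc i)) (λ i → b (fsuc i))

  LinIndep : ∀ {d} → (Fin d → Vector) → Set (c ⊔ ℓ)
  LinIndep {d} b = ∀ (a : Fin d → Carrier) → lincomb a b ≈ᵥ 0ᵥ → ∀ i → a i ≈ 0#

  -- a subspace of PG(n,q) of projective dimension d-1, given by a basis
  record Subspace (d : ℕ) : Set (c ⊔ ℓ) where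
    constructor subspace
    field
      basis : Fin d → Vector
      indep : LinIndep basis

  _∈ₛ_ : ∀ {d} → Vector → Subspace d → Set (c ⊔ ℓ)
  v ∈ₛ S = ∃[ a ] (v ≈ᵥ lincomb a (Subspace.basis S))

  _⊆ₛ_ : ∀ {d e} → Subspace d → Subspace e → Set (c ⊔ ℓ)
  S ⊆ₛ T = ∀ v → v ∈ₛ S → v ∈ₛ T

  _≐_ : ∀ {d e} → Subspace d → Subspace e → Set (c ⊔ ℓ)
  S ≐ T = S ⊆ₛ T × T ⊆ₛ S

  Point Line Plane Solid : Set (c ⊔ ℓ)
  Point = Subspace 1
  Line  = Subspace 2
  Plane = Subspace 3
  Solid = Subspace 4

  data Count {a p} {A : Set a} (P : A → Set p) : List A → ℕ → Set (a ⊔ p) where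
    []  : Count P [] 0
    yes : ∀ {x xs k} → P x → Count P xs k → Count P (x ∷ xs) (N.suc k)
    no  : ∀ {x xs k} → ¬ P x → Count P xs k → Count P (x ∷ xs) k

  LineSet : List Line → Set (c ⊔ ℓ)
  LineSet = AllPairs (λ l m → ¬ (l ≐ m))

  linesThrough : List Line → Point → ℕ → Set (c ⊔ ℓ)
  linesThrough 𝓛 P k = Count (λ l → P ⊆ₛ l) 𝓛 k

  linesIn : ∀ {d} → List Line → Subspace d → ℕ → Set (c ⊔ ℓ)
  linesIn 𝓛 S k = Count (λ l → l ⊆ₛ S) 𝓛 k

  module Conditions (q : ℕ) (𝓛 : List Line) where
    Pt : Set (c ⊔ ℓ)
    Pt = ∀ (P : Point) → ∃[ k ] (linesThrough 𝓛 P k × (k ≡ 0 ⊎ k ≡ N.suc q))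
    Pl : Set (c ⊔ ℓ)
    Pl = ∀ (π : Plane) → ∃[ k ] (linesIn 𝓛 π k × (k ≡ 0 ⊎ k ≡ 1 ⊎ k ≡ N.suc q))
    Sd : Set (c ⊔ ℓ)
    Sd = ∀ (σ : Solid) → ∃[ k ] (linesIn 𝓛 σ k ×
           (k ≡ 0 ⊎ k ≡ 1 ⊎ k ≡ N.suc q ⊎ k ≡ N.suc (2 N.* q)))
    To : Set
    To = length 𝓛 ≤ q ^ 5 N.+ q ^ 4 N.+ q ^ 3 N.+ q ^ 2 N.+ q N.+ 1

  -- 𝓛 is contained in some subspace of projective dimension at most m
  ContainedInDim≤ : List Line → ℕ → Set (c ⊔ ℓ)
  ContainedInDim≤ 𝓛 m =
    ∃[ d ] (d ≤ N.suc m × Σ (Subspace d) λ W → ∀ l → l ∈ 𝓛 → l ⊆ₛ W)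

{-# OPTIONS --safe #-}
module Submission where

-- The lines of 𝓛 through a point form a full plane pencil, there are no triangles and no
-- quadrangles, and by (Sd) the solid spanned by two skew lines i, m of 𝓛 holds at least
-- q − 1 lines other than i that do not meet m.  Let W be a subspace containing a line k of 𝓛,
-- and let m be a line of 𝓛 that meets k but is not contained in W.  The solids ⟨i , m⟩, with i
-- in W skew to k, contribute pairwise disjoint sets of q − 1 lines to ⟨W , m⟩, so the number of
-- lines grows roughly by a factor q with each new dimension.  Starting from W a line of 𝓛, six
-- such steps produce more lines than (To) allows.  Hence the process stops in vector dimension
-- at most 7, at a subspace W which contains every line of 𝓛 meeting a line of W.  Such a W
-- contains at least 1 + q + q² + q³ + q⁴ lines, and a line of 𝓛 outside it would again produce
-- too many lines.

open import Defs
open import Level using (Level; _⊔_)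
open import Data.Bool using (if_then_else_)
open import Data.Empty using (⊥-elim)
open import Data.Fin using (Fin; combine; funToFin; finToFun) renaming (zero to fzero; suc to fsuc)
import Data.Fin.Properties as Fin
open import Data.List using (List; _∷_; length; lookup)
open import Data.List.Membership.Propositional.Properties using (∈-lookup)
import Data.List.Relation.Unary.All as All
open import Data.List.Relation.Unary.AllPairs using (_∷_)
import Data.List.Relation.Unary.Any as Any
open import Data.List.Relation.Unary.Any.Properties using (lookup-index)
open import Data.Nat as ℕ using (ℕ; zero; suc; z≤n; s≤s; _≤_; _<_)
import Data.Nat.Properties as ℕ
open import Data.Nat.Solver using (module +-*-Solver)
open import Data.Product using (Σ; ∃; ∃-syntax; _×_; _,_; proj₁; proj₂)
open import Data.Sum using (_⊎_; inj₁; inj₂)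
open import Data.Unit using (⊤; tt)
open import Data.Vec.Functional using () renaming (_∷_ to _∷ᶠ_; [] to []ᶠ)
open import Function using (_∘_)
open import Relation.Binary.PropositionalEquality as ≡ using (_≡_; _≢_)
open import Relation.Nullary using (¬_; Dec; yes; no; does)
open import Relation.Nullary.Decidable using (_×-dec_; _⊎-dec_; ¬?; map′)
open import Relation.Unary using (Decidable)

-- Two solids through `m` that share a line skew to `m` coincide, so the contributions are disjoint
-- as soon as `i` is the only line of `W` in its solid. The obstacle is a line of `W` that meets
-- both `i` and `m`. Since `k` turns out to be the only line of `W` meeting `m`, it is enough to
-- discard the lines that meet `k`, but this has a price: if `W` holds a lines, g of them meeting
-- `k`, the next subspace is only guaranteed a + (q - 1)(a - 1 - g) + δ lines, where δ is the number
-- of its lines that meet `m`. A bound on a alone therefore does not propagate, and the induction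
-- weighs a against the degree of one marked line. In a closed `W` no line meets `m`, so nothing is
-- discarded; this is why a much weaker count of its lines is enough there.

module Counting where

  -- Counting decidable predicates on a finite index set

  open import Data.Nat using (_+_; _*_)
  open import Data.Nat.Properties
  open import Algebra.Properties.CommutativeSemigroup +-commutativeSemigroup using (interchange)
  open ≡ using (refl; sym; trans; subst)

  private variable
    p p′ p″ : Level
    n t : ℕ

  bit : {A : Set p} → Dec A → ℕ
  bit A? = if does A? then 1 else 0

  count : {P : Fin n → Set p} → Decidable P → ℕ
  count {n = zero}  P? = 0
  count {n = suc n} P? = bit (P? fzero) + count (P? ∘ fsuc)

  count-mono : {P : Fin n → Set p} {Q : Fin n → Set p′} (P? : Decidable P) (Q? : Decidable Q) → (∀ i → P i → Q i) → count P? ≤ count Q?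
  count-mono {n = zero}  P? Q? P⊆Q = z≤n
  count-mono {n = suc n} P? Q? P⊆Q = +-mono-≤ (head (P? fzero) (Q? fzero)) (count-mono (P? ∘ fsuc) (Q? ∘ fsuc) (P⊆Q ∘ fsuc))
    where
    head : (a : Dec _) (b : Dec _) → bit a ≤ bit b
    head (no _)  _       = z≤n
    head (yes _) (yes _) = ≤-refl
    head (yes a) (no ¬b) = ⊥-elim (¬b (P⊆Q fzero a))

  count-disjoint : {P : Fin n → Set p} {Q : Fin n → Set p′} {R : Fin n → Set p″} (P? : Decidable P) (Q? : Decidable Q) (R? : Decidable R) →
    (∀ i → P i → R i) → (∀ i → Q i → R i) → (∀ i → P i → ¬ Q i) → count P? + count Q? ≤ count R?
  count-disjoint {n = zero}  P? Q? R? P⊆R Q⊆R P∩Q = z≤n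
  count-disjoint {n = suc n} P? Q? R? P⊆R Q⊆R P∩Q =
    ≤-trans (≤-reflexive (interchange (bit (P? fzero)) (count (P? ∘ fsuc)) (bit (Q? fzero)) (count (Q? ∘ fsuc))))
      (+-mono-≤ (head (P? fzero) (Q? fzero) (R? fzero))
        (count-disjoint (P? ∘ fsuc) (Q? ∘ fsuc) (R? ∘ fsuc) (P⊆R ∘ fsuc) (Q⊆R ∘ fsuc) (P∩Q ∘ fsuc)))
    where
    head : (a : Dec _) (b : Dec _) (c : Dec _) → bit a + bit b ≤ bit c
    head (yes a) (yes b) _       = ⊥-elim (P∩Q fzero a b)
    head (yes _) (no _)  (yes _) = ≤-refl
    head (yes a) (no _)  (no ¬c) = ⊥-elim (¬c (P⊆R fzero a))
    head (no _)  (yes _) (yes _) = ≤-refl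
    head (no _)  (yes b) (no ¬c) = ⊥-elim (¬c (Q⊆R fzero b))
    head (no _)  (no _)  _       = z≤n

  count-union : {P : Fin n → Set p} {Q : Fin n → Set p′} {R : Fin n → Set p″} (P? : Decidable P) (Q? : Decidable Q) (R? : Decidable R) →
    (∀ i → R i → P i ⊎ Q i) → count R? ≤ count P? + count Q?
  count-union {n = zero}  P? Q? R? R⊆P∪Q = z≤n
  count-union {n = suc n} P? Q? R? R⊆P∪Q =
    ≤-trans (+-mono-≤ (head (P? fzero) (Q? fzero) (R? fzero))
        (count-union (P? ∘ fsuc) (Q? ∘ fsuc) (R? ∘ fsuc) (R⊆P∪Q ∘ fsuc)))
      (≤-reflexive (interchange (bit (P? fzero)) (bit (Q? fzero)) (count (P? ∘ fsuc)) (count (Q? ∘ fsuc))))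
    where
    head : (a : Dec _) (b : Dec _) (c : Dec _) → bit c ≤ bit a + bit b
    head _       _       (no _)  = z≤n
    head (yes _) _       (yes _) = s≤s z≤n
    head (no _)  (yes _) (yes _) = ≤-refl
    head (no ¬a) (no ¬b) (yes c) with R⊆P∪Q fzero c
    ... | inj₁ a = ⊥-elim (¬a a)
    ... | inj₂ b = ⊥-elim (¬b b)

  count-empty : {P : Fin n → Set p} (P? : Decidable P) → (∀ i → ¬ P i) → count P? ≤ 0
  count-empty {n = zero}  P? ¬P = z≤n
  count-empty {n = suc n} P? ¬P with P? fzero
  ... | yes x = ⊥-elim (¬P fzero x)
  ... | no _  = count-empty (P? ∘ fsuc) (¬P ∘ fsuc)

  count-member : {P : Fin n → Set p} (P? : Decidable P) (i : Fin n) → P i → 1 ≤ count P?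
  count-member P? fzero    x with P? fzero
  ... | yes _ = s≤s z≤n
  ... | no ¬x = ⊥-elim (¬x x)
  count-member P? (fsuc i) x = ≤-trans (count-member (P? ∘ fsuc) i x) (m≤n+m _ _)

  count-unique : {P : Fin n → Set p} (P? : Decidable P) → (∀ i j → P i → P j → i ≡ j) → count P? ≤ 1
  count-unique {n = zero}  P? uniq = z≤n
  count-unique {n = suc n} P? uniq with P? fzero
  ... | yes x = s≤s (count-empty (P? ∘ fsuc) λ i y → Fin.0≢1+n (uniq fzero (fsuc i) x y))
  ... | no _  = count-unique (P? ∘ fsuc) λ i j x y → Fin.suc-injective (uniq _ _ x y)

  count-≡ : (i : Fin n) → count (Fin._≟ i) ≤ 1
  count-≡ i = count-unique (Fin._≟ i) λ _ _ j≡i k≡i → trans j≡i (sym k≡i)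

  count-all : {P : Fin n → Set p} (P? : Decidable P) → (∀ i → P i) → n ≤ count P?
  count-all {n = zero}  P? all = z≤n
  count-all {n = suc n} P? all with P? fzero
  ... | yes _ = s≤s (count-all (P? ∘ fsuc) (all ∘ fsuc))
  ... | no ¬x = ⊥-elim (¬x (all fzero))

  count-≤n : {P : Fin n → Set p} (P? : Decidable P) → count P? ≤ n
  count-≤n {n = zero}  P? = z≤n
  count-≤n {n = suc n} P? with P? fzero
  ... | yes _ = s≤s (count-≤n (P? ∘ fsuc))
  ... | no _  = m≤n⇒m≤1+n (count-≤n (P? ∘ fsuc))

  without? : {P : Fin n → Set p} (P? : Decidable P) (i : Fin n) → Decidable (λ j → P j × j ≢ i)
  without? P? i j = P? j ×-dec ¬? (j Fin.≟ i)

  count-without : {P : Fin n → Set p} (P? : Decidable P) (i : Fin n) → count P? ≤ 1 + count (without? P? i)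
  count-without {P = P} P? i = ≤-trans (count-union (Fin._≟ i) (without? P? i) P? split)
      (+-monoˡ-≤ _ (count-≡ i))
    where
    split : ∀ j → P j → j ≡ i ⊎ (P j × j ≢ i)
    split j x with j Fin.≟ i
    ... | yes e = inj₁ e
    ... | no ne = inj₂ (x , ne)

  count-insert : {P : Fin n → Set p} {Q : Fin n → Set p′} (P? : Decidable P) (Q? : Decidable Q) → (∀ j → P j → Q j) →
    ∀ i → Q i → ¬ P i → 1 + count P? ≤ count Q?
  count-insert {Q = Q} P? Q? P⊆Q i y ¬x =
    ≤-trans (+-monoˡ-≤ (count P?) (count-member (Fin._≟ i) i refl))
      (count-disjoint (Fin._≟ i) P? Q? (λ j e → subst Q (sym e) y) P⊆Q (λ { j refl x → ¬x x }))

  count-full : {P : Fin n → Set p} {Q : Fin n → Set p′} (P? : Decidable P) (Q? : Decidable Q) → (∀ i → P i → Q i) → count Q? ≤ count P? →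
    ∀ i → Q i → P i
  count-full P? Q? P⊆Q Q≤P i y with P? i
  ... | yes x = x
  ... | no ¬x = ⊥-elim (<-irrefl refl (≤-trans (count-insert P? Q? P⊆Q i y ¬x) Q≤P))

  count-pair : {P : Fin n → Set p} (P? : Decidable P) → ∀ i j → P i → P j → i ≢ j → 2 ≤ count P?
  count-pair {P = P} P? i j x y i≢j = ≤-trans (s≤s (count-member (Fin._≟ i) i refl))
    (count-insert (Fin._≟ i) P? (λ k e → subst P (sym e) x) j y (i≢j ∘ sym))

  -- Size and disjointness are asked only of the indices in `G`, so a family may be arbitrary
  -- elsewhere. The induction removes the members of `M fzero` from `R`.
  count-packing : {R : Fin n → Set p″} {G : Fin t → Set p} {M : Fin t → Fin n → Set p′} {k : ℕ}
    (G? : Decidable G) (M? : ∀ s → Decidable (M s)) (R? : Decidable R) →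
    (∀ s → G s → k ≤ count (M? s)) → (∀ s j → G s → M s j → R j) →
    (∀ s s′ j → G s → G s′ → M s j → M s′ j → s ≡ s′) → count G? * k ≤ count R?
  count-packing {t = zero}  G? M? R? large M⊆R disj = z≤n
  count-packing {t = suc t} {R = R} {G} {M} G? M? R? large M⊆R disj with G? fzero
  ... | no _  = count-packing (G? ∘ fsuc) (M? ∘ fsuc) R? (large ∘ fsuc) (M⊆R ∘ fsuc)
                  λ s s′ j g g′ x x′ → Fin.suc-injective (disj _ _ j g g′ x x′)
  ... | yes g = ≤-trans
      (+-mono-≤ (large fzero g)
        (count-packing (G? ∘ fsuc) (M? ∘ fsuc) rest? (large ∘ fsuc)
          (λ s j g′ x → M⊆R (fsuc s) j g′ x , λ y → Fin.0≢1+n (disj _ _ j g g′ y x))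
          (λ s s′ j g g′ x x′ → Fin.suc-injective (disj _ _ j g g′ x x′))))
      (count-disjoint (M? fzero) rest? R? (λ j → M⊆R fzero j g) (λ _ → proj₁) (λ j x y → proj₂ y x))
    where
    rest? : Decidable (λ j → R j × ¬ M fzero j)
    rest? j = R? j ×-dec ¬? (M? fzero j)

  count-covering : {R : Fin n → Set p″} {M : Fin t → Fin n → Set p′} {k : ℕ}
    (M? : ∀ s → Decidable (M s)) (R? : Decidable R) →
    (∀ s → count (M? s) ≤ k) → (∀ j → R j → ∃[ s ] M s j) → count R? ≤ t * k
  count-covering {t = zero}  M? R? small cov = count-empty R? λ j y → Fin.¬Fin0 (proj₁ (cov j y))
  count-covering {t = suc t} {R = R} {M} M? R? small cov =
    ≤-trans (count-union (M? fzero) rest? R? split)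
      (+-mono-≤ (small fzero) (count-covering (M? ∘ fsuc) rest? (small ∘ fsuc) cov′))
    where
    rest? : Decidable (λ j → R j × ¬ M fzero j)
    rest? j = R? j ×-dec ¬? (M? fzero j)
    split : ∀ j → R j → M fzero j ⊎ (R j × ¬ M fzero j)
    split j y with M? fzero j
    ... | yes x = inj₁ x
    ... | no ¬x = inj₂ (y , ¬x)
    cov′ : ∀ j → R j × ¬ M fzero j → ∃[ s ] M (fsuc s) j
    cov′ j (y , ¬x) with cov j y
    ... | fzero , x  = ⊥-elim (¬x x)
    ... | fsuc s , x = s , x

open Counting

module LinearAlgebra {c ℓ} (F : Field c ℓ) (q n : ℕ) (order : HasOrder F q) where

  open Field F
  open Geometry F n hiding (yes; no; [])
  open import Algebra.Properties.Ring ring using (-1*x≈-x)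
  open import Algebra.Properties.CommutativeSemigroup +-commutativeSemigroup using (interchange)
  open import Relation.Binary.Reasoning.Setoid setoid

  private variable
    d e k : ℕ

  -- Enumeration of the field and decidability

  elem : Fin q → Carrier
  elem = proj₁ order

  elem-injective : ∀ i j → elem i ≈ elem j → i ≡ j
  elem-injective = proj₁ (proj₂ order)

  index : Carrier → Fin q
  index x = proj₁ (proj₂ (proj₂ order) x)

  elem-index : ∀ x → elem (index x) ≈ x
  elem-index x = proj₂ (proj₂ (proj₂ order) x)

  _≈?_ : ∀ x y → Dec (x ≈ y)
  x ≈? y = map′ (λ eq → trans (sym (elem-index x)) (trans (reflexive (≡.cong elem eq)) (elem-index y)))
                (λ eq → elem-injective _ _ (trans (elem-index x) (trans eq (sym (elem-index y)))))
                (index x Fin.≟ index y)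

  1<q : 1 < q
  1<q = Fin.injective⇒≤ {f = f} f-injective
    where
    f : Fin 2 → Fin q
    f fzero    = index 0#
    f (fsuc _) = index 1#
    index-injective : ∀ {x y} → index x ≡ index y → x ≈ y
    index-injective eq = trans (sym (elem-index _)) (trans (reflexive (≡.cong elem eq)) (elem-index _))
    f-injective : ∀ {i j} → f i ≡ f j → i ≡ j
    f-injective {fzero}       {fzero}       _  = ≡.refl
    f-injective {fzero}       {fsuc fzero}  eq = ⊥-elim (0≉1 (index-injective eq))
    f-injective {fsuc fzero}  {fzero}       eq = ⊥-elim (0≉1 (sym (index-injective eq)))
    f-injective {fsuc fzero}  {fsuc fzero}  _  = ≡.refl

  -- Exhaustive search over all coefficient vectors. The enumeration reaches a field element only up
  -- to `≈`, and `resp` makes `P` insensitive to this.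
  ∃-coefficients? : ∀ {p} d (P : (Fin d → Carrier) → Set p) → (∀ {a b} → (∀ i → a i ≈ b i) → P a → P b) →
    (∀ a → Dec (P a)) → Dec (∃ P)
  ∃-coefficients? zero    P resp P? = map′ (λ x → _ , x) (λ (a , x) → resp (λ ()) x) (P? []ᶠ)
  ∃-coefficients? (suc d) P resp P? = map′
    (λ (i , a , x) → elem i ∷ᶠ a , x)
    (λ (a , x) → index (a fzero) , a ∘ fsuc , resp (λ { fzero → sym (elem-index _) ; (fsuc i) → refl }) x)
    (Fin.any? λ i → ∃-coefficients? d (λ a → P (elem i ∷ᶠ a))
      (λ eq → resp λ { fzero → refl ; (fsuc j) → eq j }) (λ a → P? (elem i ∷ᶠ a)))

  -- Linear combinations and membership in a span

  lincomb-cong : ∀ {a a′ : Fin d → Carrier} b → (∀ i → a i ≈ a′ i) → lincomb a b ≈ᵥ lincomb a′ b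
  lincomb-cong {zero}  b eq i = refl
  lincomb-cong {suc d} b eq i = +-cong (*-congʳ (eq fzero)) (lincomb-cong (b ∘ fsuc) (eq ∘ fsuc) i)

  lincomb-zero : ∀ (b : Fin d → Vector) → lincomb (λ _ → 0#) b ≈ᵥ 0ᵥ
  lincomb-zero {zero}  b i = refl
  lincomb-zero {suc d} b i = trans (+-cong (zeroˡ _) (lincomb-zero (b ∘ fsuc) i)) (+-identityˡ _)

  lincomb-+ : ∀ (a a′ : Fin d → Carrier) b → lincomb (λ i → a i + a′ i) b ≈ᵥ (lincomb a b +ᵥ lincomb a′ b)
  lincomb-+ {zero}  a a′ b i = sym (+-identityˡ _)
  lincomb-+ {suc d} a a′ b i = trans (+-cong (distribʳ _ _ _) (lincomb-+ (a ∘ fsuc) (a′ ∘ fsuc) (b ∘ fsuc) i)) (interchange _ _ _ _)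

  lincomb-· : ∀ x (a : Fin d → Carrier) b → lincomb (λ i → x * a i) b ≈ᵥ (x ·ᵥ lincomb a b)
  lincomb-· {zero}  x a b i = sym (zeroʳ _)
  lincomb-· {suc d} x a b i = trans (+-cong (*-assoc _ _ _) (lincomb-· x (a ∘ fsuc) (b ∘ fsuc) i)) (sym (distribˡ _ _ _))

  open Subspace

  ∈-resp : ∀ {u v} (S : Subspace d) → u ≈ᵥ v → u ∈ₛ S → v ∈ₛ S
  ∈-resp S eq (a , ua) = a , λ i → trans (sym (eq i)) (ua i)

  ∈-0 : (S : Subspace d) → 0ᵥ ∈ₛ S
  ∈-0 S = _ , λ i → sym (lincomb-zero (basis S) i)

  ∈-+ : ∀ {u v} (S : Subspace d) → u ∈ₛ S → v ∈ₛ S → (u +ᵥ v) ∈ₛ S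
  ∈-+ S (a , ua) (b , vb) = _ , λ i → trans (+-cong (ua i) (vb i)) (sym (lincomb-+ a b (basis S) i))

  ∈-· : ∀ {u} (S : Subspace d) x → u ∈ₛ S → (x ·ᵥ u) ∈ₛ S
  ∈-· S x (a , ua) = _ , λ i → trans (*-congˡ (ua i)) (sym (lincomb-· x a (basis S) i))

  ∈-cancelʳ : ∀ {u v} (S : Subspace d) → (u +ᵥ v) ∈ₛ S → v ∈ₛ S → u ∈ₛ S
  ∈-cancelʳ {u = u} {v} S u+v∈ v∈ = ∈-resp S
    (λ i → begin
      (u i + v i) + - 1# * v i  ≈⟨ +-congˡ (-1*x≈-x _) ⟩
      (u i + v i) + - v i       ≈⟨ +-assoc _ _ _ ⟩
      u i + (v i + - v i)       ≈⟨ +-congˡ (-‿inverseʳ _) ⟩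
      u i + 0#                  ≈⟨ +-identityʳ _ ⟩
      u i                       ∎)
    (∈-+ S u+v∈ (∈-· S (- 1#) v∈))

  ∈-unscale : ∀ {u} (S : Subspace d) x → ¬ (x ≈ 0#) → (x ·ᵥ u) ∈ₛ S → u ∈ₛ S
  ∈-unscale {u = u} S x x≉0 xu∈ with inverse x x≉0
  ... | y , xy≈1 = ∈-resp S
    (λ i → trans (sym (*-assoc _ _ _)) (trans (*-congʳ (trans (*-comm _ _) xy≈1)) (*-identityˡ _)))
    (∈-· S y xu∈)

  lincomb-∈ : ∀ (S : Subspace e) (a : Fin d → Carrier) b → (∀ i → b i ∈ₛ S) → lincomb a b ∈ₛ S
  lincomb-∈ {d = zero}  S a b b∈ = ∈-0 S
  lincomb-∈ {d = suc d} S a b b∈ = ∈-+ S (∈-· S _ (b∈ fzero)) (lincomb-∈ S (a ∘ fsuc) (b ∘ fsuc) (b∈ ∘ fsuc))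

  basis-∈ : (S : Subspace d) → ∀ i → basis S i ∈ₛ S
  basis-∈ S = go (basis S)
    where
    go : ∀ {d} (b : Fin d → Vector) i → ∃[ a ] (b i ≈ᵥ lincomb a b)
    go b fzero    = 1# ∷ᶠ (λ _ → 0#) , λ i →
      sym (trans (+-cong (*-identityˡ _) (lincomb-zero (b ∘ fsuc) i)) (+-identityʳ _))
    go b (fsuc j) with go (b ∘ fsuc) j
    ... | a , eq = 0# ∷ᶠ a , λ i → trans (eq i) (sym (trans (+-congʳ (zeroˡ _)) (+-identityˡ _)))

  generated-⊆ : (S : Subspace d) (T : Subspace e) → (∀ i → basis S i ∈ₛ T) → S ⊆ₛ T
  generated-⊆ S T b∈ v (a , eq) = ∈-resp T (λ i → sym (eq i)) (lincomb-∈ T a (basis S) b∈)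

  ⊆-refl : (S : Subspace d) → S ⊆ₛ S
  ⊆-refl S v v∈ = v∈

  abstract
    _∈?_ : ∀ v (S : Subspace d) → Dec (v ∈ₛ S)
    v ∈? S = ∃-coefficients? _ _ (λ eq va i → trans (va i) (lincomb-cong (basis S) eq i))
               (λ a → Fin.all? λ i → v i ≈? lincomb a (basis S) i)

    _⊆?_ : (S : Subspace d) (T : Subspace e) → Dec (S ⊆ₛ T)
    S ⊆? T = map′ (generated-⊆ S T) (λ S⊆T i → S⊆T _ (basis-∈ S i)) (Fin.all? λ i → basis S i ∈? T)

  ⊈-witness : (S : Subspace d) (T : Subspace e) → ¬ (S ⊆ₛ T) → ∃[ v ] (v ∈ₛ S × ¬ (v ∈ₛ T))
  ⊈-witness S T S⊈T with Fin.¬∀⟶∃¬ _ _ (λ i → basis S i ∈? T) (S⊈T ∘ generated-⊆ S T)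
  ... | i , ∉T = basis S i , basis-∈ S i , ∉T

  -- Adjoining a vector; dimension

  abstract
    extend-indep : (S : Subspace d) (v : Vector) → ¬ (v ∈ₛ S) → LinIndep (v ∷ᶠ basis S)
    extend-indep S v v∉ a eq with a fzero ≈? 0#
    ... | yes a₀≈0 = λ { fzero → a₀≈0 ; (fsuc i) → indep S (a ∘ fsuc) eq′ i }
      where
      eq′ : lincomb (a ∘ fsuc) (basis S) ≈ᵥ 0ᵥ
      eq′ i = trans (sym (trans (+-congʳ (trans (*-congʳ a₀≈0) (zeroˡ _))) (+-identityˡ _))) (eq i)
    ... | no a₀≉0 = ⊥-elim (v∉ (∈-unscale S _ a₀≉0
      (∈-cancelʳ S (∈-resp S (λ i → sym (eq i)) (∈-0 S)) (lincomb-∈ S (a ∘ fsuc) (basis S) (basis-∈ S)))))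

  extend : (S : Subspace d) (v : Vector) → ¬ (v ∈ₛ S) → Subspace (suc d)
  extend S v v∉ = subspace (v ∷ᶠ basis S) (extend-indep S v v∉)

  module _ (S : Subspace d) {v : Vector} (v∉ : ¬ (v ∈ₛ S)) where

    ∈-extend : v ∈ₛ extend S v v∉
    ∈-extend = basis-∈ (extend S v v∉) fzero

    ⊆-extend : S ⊆ₛ extend S v v∉
    ⊆-extend = generated-⊆ S (extend S v v∉) (basis-∈ (extend S v v∉) ∘ fsuc)

    extend-⊆ : (T : Subspace e) → S ⊆ₛ T → v ∈ₛ T → extend S v v∉ ⊆ₛ T
    extend-⊆ T S⊆T v∈T = generated-⊆ (extend S v v∉) T λ { fzero → v∈T ; (fsuc i) → S⊆T _ (basis-∈ S i) }

  trivial : Subspace 0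
  trivial = subspace (λ ()) (λ _ _ ())

  NonZero : Vector → Set ℓ
  NonZero v = ¬ (v ≈ᵥ 0ᵥ)

  ⟨_⟩ : ∀ {v} → NonZero v → Point
  ⟨_⟩ {v} v≉0 = extend trivial v λ (a , eq) → v≉0 eq

  ∈-⟨⟩ : ∀ {v} (v≉0 : NonZero v) → v ∈ₛ ⟨ v≉0 ⟩
  ∈-⟨⟩ v≉0 = ∈-extend trivial λ (a , eq) → v≉0 eq

  ⟨⟩-⊆ : ∀ {v} (v≉0 : NonZero v) (S : Subspace d) → v ∈ₛ S → ⟨ v≉0 ⟩ ⊆ₛ S
  ⟨⟩-⊆ v≉0 S v∈ = extend-⊆ trivial (λ (a , eq) → v≉0 eq) S (λ v (a , eq) → ∈-resp S (λ i → sym (eq i)) (∈-0 S)) v∈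

  ∉⇒NonZero : ∀ {v} (S : Subspace d) → ¬ (v ∈ₛ S) → NonZero v
  ∉⇒NonZero S v∉ v≈0 = v∉ (∈-resp S (λ i → sym (v≈0 i)) (∈-0 S))

  indep-injective : (S : Subspace d) {a b : Fin d → Carrier} →
    lincomb a (basis S) ≈ᵥ lincomb b (basis S) → ∀ i → a i ≈ b i
  indep-injective S {a} {b} eq i = begin
    a i                          ≈⟨ +-identityʳ _ ⟨
    a i + 0#                     ≈⟨ +-congˡ (-‿inverseˡ _) ⟨
    a i + (- b i + b i)          ≈⟨ +-assoc _ _ _ ⟨
    (a i + - b i) + b i          ≈⟨ +-congʳ (+-congˡ (-1*x≈-x _)) ⟨
    (a i + - 1# * b i) + b i     ≈⟨ +-congʳ (indep S _ combination≈0 i) ⟩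
    0# + b i                     ≈⟨ +-identityˡ _ ⟩
    b i                          ∎
    where
    combination≈0 : lincomb (λ j → a j + - 1# * b j) (basis S) ≈ᵥ 0ᵥ
    combination≈0 j = begin
      lincomb (λ j → a j + - 1# * b j) (basis S) j                  ≈⟨ lincomb-+ _ _ (basis S) j ⟩
      lincomb a (basis S) j + lincomb (λ j → - 1# * b j) (basis S) j  ≈⟨ +-cong (eq j) (lincomb-· _ _ (basis S) j) ⟩
      lincomb b (basis S) j + - 1# * lincomb b (basis S) j          ≈⟨ +-congˡ (-1*x≈-x _) ⟩
      lincomb b (basis S) j + - lincomb b (basis S) j               ≈⟨ -‿inverseʳ _ ⟩
      0#                                                            ∎

  funToFin-cong : {f g : Fin d → Fin k} → (∀ i → f i ≡ g i) → funToFin f ≡ funToFin g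
  funToFin-cong {zero}  eq = ≡.refl
  funToFin-cong {suc d} eq = ≡.cong₂ combine (eq fzero) (funToFin-cong (eq ∘ fsuc))

  abstract
    -- A subspace of dimension d has q ^ d vectors.
    dim-mono : (S : Subspace d) (T : Subspace e) → S ⊆ₛ T → d ≤ e
    dim-mono {d} {e} S T S⊆T = ℕ.≮⇒≥ λ e<d →
      ℕ.<-irrefl ≡.refl (ℕ.≤-trans (ℕ.^-monoʳ-< q 1<q e<d) (Fin.injective⇒≤ {f = f} f-injective))
      where
      vec : Fin (q ℕ.^ d) → Vector
      vec i = lincomb (elem ∘ finToFun i) (basis S)
      vec∈T : ∀ i → vec i ∈ₛ T
      vec∈T i = S⊆T _ (_ , λ _ → refl)
      coeff : Fin (q ℕ.^ d) → Fin e → Carrier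
      coeff i = proj₁ (vec∈T i)
      f : Fin (q ℕ.^ d) → Fin (q ℕ.^ e)
      f i = funToFin (index ∘ coeff i)
      f-injective : ∀ {i j} → f i ≡ f j → i ≡ j
      f-injective {i} {j} eq = ≡.trans (≡.sym (Fin.funToFin-finToFin {d} {q} i))
        (≡.trans (funToFin-cong (λ k → elem-injective _ _ (indep-injective S vec≈ k))) (Fin.funToFin-finToFin {d} {q} j))
        where
        index≡ : ∀ k → index (coeff i k) ≡ index (coeff j k)
        index≡ k = ≡.trans (≡.sym (Fin.finToFun-funToFin (index ∘ coeff i) k))
          (≡.trans (≡.cong (λ z → finToFun z k) eq) (Fin.finToFun-funToFin (index ∘ coeff j) k))
        coeff≈ : ∀ k → coeff i k ≈ coeff j k
        coeff≈ k = trans (sym (elem-index _)) (trans (reflexive (≡.cong elem (index≡ k))) (elem-index _))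
        vec≈ : vec i ≈ᵥ vec j
        vec≈ k = trans (proj₂ (vec∈T i) k) (trans (lincomb-cong (basis T) coeff≈ k) (sym (proj₂ (vec∈T j) k)))

    ⊆-equal-dim : (S T : Subspace d) → S ⊆ₛ T → T ⊆ₛ S
    ⊆-equal-dim S T S⊆T v v∈T with v ∈? S
    ... | yes v∈S = v∈S
    ... | no v∉S  = ⊥-elim (ℕ.1+n≰n (dim-mono (extend S v v∉S) T (extend-⊆ S v∉S T S⊆T v∈T)))

  line-⊈-point : ∀ {v} (l : Line) (v≉0 : NonZero v) → ∃[ w ] (w ∈ₛ l × ¬ (w ∈ₛ ⟨ v≉0 ⟩))
  line-⊈-point l v≉0 = ⊈-witness l ⟨ v≉0 ⟩ λ l⊆v → ℕ.<⇒≱ (ℕ.n<1+n 1) (dim-mono l ⟨ v≉0 ⟩ l⊆v)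

  -- `S` separates `x` from `y`: it contains every multiple of `x`, so `y` is none of them, and the
  -- two vectors span `l`.
  line-⊆ : ∀ {x y} (l : Line) (S : Subspace d) (T : Subspace e) → NonZero x →
    x ∈ₛ l → y ∈ₛ l → x ∈ₛ S → ¬ (y ∈ₛ S) → x ∈ₛ T → y ∈ₛ T → l ⊆ₛ T
  line-⊆ {y = y} l S T x≉0 x∈l y∈l x∈S y∉S x∈T y∈T v v∈l =
    extend-⊆ ⟨ x≉0 ⟩ y∉x T (⟨⟩-⊆ x≉0 T x∈T) y∈T v
      (⊆-equal-dim (extend ⟨ x≉0 ⟩ y y∉x) l (extend-⊆ ⟨ x≉0 ⟩ y∉x l (⟨⟩-⊆ x≉0 l x∈l) y∈l) v v∈l)
    where
    y∉x : ¬ (y ∈ₛ ⟨ x≉0 ⟩)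
    y∉x y∈ = y∉S (⟨⟩-⊆ x≉0 S x∈S y y∈)

  -- Points of a line and intersections with subspaces

  Meet : Line → Subspace d → Set (c ⊔ ℓ)
  Meet l S = ∃[ p ] (NonZero p × p ∈ₛ l × p ∈ₛ S)

  -- Write the second basis vector as v = αu + s with s in `S`. Then s = v - αu lies on `l`, and it
  -- is nonzero because u and v are independent.
  meet-of-extend : (l : Line) (S : Subspace d) (u∉S : ¬ (basis l fzero ∈ₛ S)) →
    basis l (fsuc fzero) ∈ₛ extend S (basis l fzero) u∉S → Meet l S
  meet-of-extend l S u∉S (a , eq) = s , s≉0 , s∈l , lincomb-∈ S _ _ (basis-∈ S)
    where
    u v s : Vector
    u = basis l fzero
    v = basis l (fsuc fzero)
    s = lincomb (a ∘ fsuc) (basis S)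
    s∈l : s ∈ₛ l
    s∈l = ∈-cancelʳ l (∈-resp l (λ i → trans (eq i) (+-comm _ _)) (basis-∈ l (fsuc fzero)))
      (∈-· l (a fzero) (basis-∈ l fzero))
    s≉0 : NonZero s
    s≉0 s≈0 = 0≉1 (indep-injective l {a fzero ∷ᶠ 0# ∷ᶠ []ᶠ} {0# ∷ᶠ 1# ∷ᶠ []ᶠ} (λ i → begin
      a fzero * u i + (0# * v i + 0#)  ≈⟨ +-congˡ (trans (+-identityʳ _) (zeroˡ _)) ⟩
      a fzero * u i + 0#               ≈⟨ +-congˡ (s≈0 i) ⟨
      a fzero * u i + s i              ≈⟨ eq i ⟨
      v i                              ≈⟨ *-identityˡ _ ⟨
      1# * v i                         ≈⟨ +-identityʳ _ ⟨
      1# * v i + 0#                    ≈⟨ +-identityˡ _ ⟨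
      0# + (1# * v i + 0#)             ≈⟨ +-congʳ (zeroˡ _) ⟨
      0# * u i + (1# * v i + 0#)       ∎) (fsuc fzero))

  -- One representative per projective point: a vector is scaled to second coordinate 1, or to first
  -- coordinate 1 if the second vanishes.
  point : Line → Fin (suc q) → Vector
  point l fzero    = basis l fzero
  point l (fsuc i) = basis l (fsuc fzero) +ᵥ (elem i ·ᵥ basis l fzero)

  point-∈ : (l : Line) → ∀ t → point l t ∈ₛ l
  point-∈ l fzero    = basis-∈ l fzero
  point-∈ l (fsuc i) = ∈-+ l (basis-∈ l (fsuc fzero)) (∈-· l (elem i) (basis-∈ l fzero))

  point-NonZero : (l : Line) → ∀ t → NonZero (point l t)
  point-NonZero l fzero    u≈0 = 0≉1 (sym (indep l (1# ∷ᶠ 0# ∷ᶠ []ᶠ)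
    (λ i → trans (+-cong (trans (*-identityˡ _) (u≈0 i)) (trans (+-identityʳ _) (zeroˡ _))) (+-identityˡ _)) fzero))
  point-NonZero l (fsuc j) p≈0 = 0≉1 (sym (indep l (elem j ∷ᶠ 1# ∷ᶠ []ᶠ)
    (λ i → trans (+-congˡ (trans (+-identityʳ _) (*-identityˡ _))) (trans (+-comm _ _) (p≈0 i))) (fsuc fzero)))

  -- `S` is a hyperplane of `T`: adjoining to it a basis vector of `l` that it misses yields all of
  -- `T`, so the other basis vector lies in that extension.
  meet-line : (l : Line) (S : Subspace d) (T : Subspace (suc d)) → l ⊆ₛ T → S ⊆ₛ T → Meet l S
  meet-line l S T l⊆T S⊆T with basis l fzero ∈? S
  ... | yes u∈S = basis l fzero , point-NonZero l fzero , basis-∈ l fzero , u∈S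
  ... | no u∉S  = meet-of-extend l S u∉S
    (⊆-equal-dim (extend S _ u∉S) T (extend-⊆ S u∉S T S⊆T (l⊆T _ (basis-∈ l fzero))) _ (l⊆T _ (basis-∈ l (fsuc fzero))))

  meet-at-point : (l : Line) (S : Subspace d) → Meet l S → ∃[ t ] (point l t ∈ₛ S)
  meet-at-point l S (w , w≉0 , (a , eq) , w∈S) with a (fsuc fzero) ≈? 0#
  ... | yes β≈0 = fzero , ∈-unscale S (a fzero) α≉0 (∈-resp S w≈αu w∈S)
    where
    w≈αu : w ≈ᵥ (a fzero ·ᵥ basis l fzero)
    w≈αu i = trans (eq i) (trans (+-congˡ (trans (+-identityʳ _) (trans (*-congʳ β≈0) (zeroˡ _)))) (+-identityʳ _))
    α≉0 : ¬ (a fzero ≈ 0#)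
    α≉0 α≈0 = w≉0 λ i → trans (w≈αu i) (trans (*-congʳ α≈0) (zeroˡ _))
  ... | no β≉0 with inverse (a (fsuc fzero)) β≉0
  -- Dividing w = αu + βv by β gives the normalised point with coefficient α/β.
  ...   | y , βy≈1 = fsuc (index (y * a fzero)) , ∈-resp S eq′ (∈-· S y w∈S)
    where
    u v : Vector
    u = basis l fzero
    v = basis l (fsuc fzero)
    eq′ : (y ·ᵥ w) ≈ᵥ point l (fsuc (index (y * a fzero)))
    eq′ i = begin
      y * w i                                             ≈⟨ *-congˡ (eq i) ⟩
      y * (a fzero * u i + (a (fsuc fzero) * v i + 0#))   ≈⟨ *-congˡ (+-congˡ (+-identityʳ _)) ⟩
      y * (a fzero * u i + a (fsuc fzero) * v i)          ≈⟨ distribˡ _ _ _ ⟩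
      y * (a fzero * u i) + y * (a (fsuc fzero) * v i)    ≈⟨ +-cong (*-assoc _ _ _) (*-assoc _ _ _) ⟨
      (y * a fzero) * u i + (y * a (fsuc fzero)) * v i    ≈⟨ +-congˡ (*-congʳ (trans (*-comm _ _) βy≈1)) ⟩
      (y * a fzero) * u i + 1# * v i                      ≈⟨ +-cong (*-congʳ (elem-index _)) (sym (*-identityˡ _)) ⟨
      elem (index (y * a fzero)) * u i + v i              ≈⟨ +-comm _ _ ⟩
      v i + elem (index (y * a fzero)) * u i              ∎

  two-points-⊆ : (l : Line) (S : Subspace d) → ∀ s t → s ≢ t → point l s ∈ₛ S → point l t ∈ₛ S → l ⊆ₛ S
  two-points-⊆ l S = go
    where
    u v : Vector
    u = basis l fzero
    v = basis l (fsuc fzero)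
    done : ∀ j → u ∈ₛ S → point l (fsuc j) ∈ₛ S → l ⊆ₛ S
    done j u∈ p∈ = generated-⊆ l S λ { fzero → u∈ ; (fsuc fzero) → ∈-cancelʳ S p∈ (∈-· S (elem j) u∈) }
    -- Two normalised points differ by (x - y)u, so a nonzero x - y puts u into `S`.
    difference : ∀ x y i → (x + - y) * u i + (v i + y * u i) ≈ v i + x * u i
    difference x y i = begin
      (x + - y) * u i + (v i + y * u i)        ≈⟨ +-congˡ (+-comm _ _) ⟩
      (x + - y) * u i + (y * u i + v i)        ≈⟨ +-assoc _ _ _ ⟨
      ((x + - y) * u i + y * u i) + v i        ≈⟨ +-congʳ (distribʳ _ _ _) ⟨
      ((x + - y) + y) * u i + v i              ≈⟨ +-congʳ (*-congʳ (trans (+-assoc _ _ _) (trans (+-congˡ (-‿inverseˡ _)) (+-identityʳ _)))) ⟩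
      x * u i + v i                            ≈⟨ +-comm _ _ ⟩
      v i + x * u i                            ∎
    go : ∀ s t → s ≢ t → point l s ∈ₛ S → point l t ∈ₛ S → l ⊆ₛ S
    go fzero    fzero    s≢t _  _  = ⊥-elim (s≢t ≡.refl)
    go fzero    (fsuc j) _   u∈ p∈ = done j u∈ p∈
    go (fsuc i) fzero    _   p∈ u∈ = done i u∈ p∈
    go (fsuc i) (fsuc j) s≢t p∈ r∈ = done j u∈ r∈
      where
      x≉0 : ¬ (elem i + - elem j ≈ 0#)
      x≉0 x≈0 = s≢t (≡.cong fsuc (elem-injective i j (begin
        elem i                          ≈⟨ +-identityʳ _ ⟨
        elem i + 0#                     ≈⟨ +-congˡ (-‿inverseˡ _) ⟨
        elem i + (- elem j + elem j)    ≈⟨ +-assoc _ _ _ ⟨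
        (elem i + - elem j) + elem j    ≈⟨ +-congʳ x≈0 ⟩
        0# + elem j                     ≈⟨ +-identityˡ _ ⟩
        elem j                          ∎)))
      u∈ : u ∈ₛ S
      u∈ = ∈-unscale S (elem i + - elem j) x≉0
        (∈-cancelʳ S (∈-resp S (λ k → sym (difference _ _ k)) p∈) r∈)

  abstract
    meet? : (l : Line) (S : Subspace d) → Dec (Meet l S)
    meet? l S = map′ (λ (t , p∈) → point l t , point-NonZero l t , point-∈ l t , p∈) (meet-at-point l S)
      (Fin.any? λ t → point l t ∈? S)

module Configuration {c ℓ} (F : Field c ℓ) (Q n : ℕ) (order : HasOrder F (suc Q))
  (𝓛 : List (Geometry.Line F n)) (distinct : Geometry.LineSet F n 𝓛)
  (pt : Geometry.Conditions.Pt F n (suc Q) 𝓛) (pl : Geometry.Conditions.Pl F n (suc Q) 𝓛)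
  (sd : Geometry.Conditions.Sd F n (suc Q) 𝓛) where

  open import Data.Nat using (_+_; _*_; _^_)
  open ≡ using (refl; sym; trans; cong; subst)
  open Geometry F n hiding (yes; no; [])
  open LinearAlgebra F (suc Q) n order
  open Subspace

  q b : ℕ
  q = suc Q
  b = length 𝓛

  private variable
    d e : ℕ
    i j k m : Fin b
    x y : Vector

  -- The indexed family of lines and the counts given by the conditions

  L : Fin b → Line
  L = lookup 𝓛

  In : Subspace d → Fin b → Set (c ⊔ ℓ)
  In S i = L i ⊆ₛ S

  in? : (S : Subspace d) → Decidable (In S)
  in? S i = L i ⊆? S

  Through : Vector → Fin b → Set (c ⊔ ℓ)
  Through x i = x ∈ₛ L i

  through? : ∀ x → Decidable (Through x)
  through? x i = x ∈? L i

  -- Carries the conditions, stated through the relation `Count` on lists, over to the computed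
  -- `count` on indices.
  Count⇒count : ∀ {p} {P : Line → Set p} (P? : ∀ l → Dec (P l)) {xs k} →
    Count P xs k → count (λ i → P? (lookup xs i)) ≡ k
  Count⇒count P? Count.[] = refl
  Count⇒count P? (Count.yes {x = l} h r) with P? l
  ... | yes _ = cong suc (Count⇒count P? r)
  ... | no ¬h = ⊥-elim (¬h h)
  Count⇒count P? (Count.no {x = l} ¬h r) with P? l
  ... | yes h = ⊥-elim (¬h h)
  ... | no _  = Count⇒count P? r

  ≐-sym : {l l′ : Line} → l ≐ l′ → l′ ≐ l
  ≐-sym (⊆ , ⊇) = ⊇ , ⊆

  lookup-distinct : ∀ {xs} → LineSet xs → ∀ i j → i ≢ j → ¬ (lookup xs i ≐ lookup xs j)
  lookup-distinct {l ∷ xs} (l≠ ∷ _)  fzero    fzero    i≢j = ⊥-elim (i≢j refl)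
  lookup-distinct {l ∷ xs} (l≠ ∷ _)  fzero    (fsuc j) _   eq = All.lookup l≠ (∈-lookup j) eq
  lookup-distinct {l ∷ xs} (l≠ ∷ _)  (fsuc i) fzero    _   eq =
    All.lookup l≠ (∈-lookup i) (≐-sym {lookup xs i} {l} eq)
  lookup-distinct {l ∷ xs} (_ ∷ ≠xs) (fsuc i) (fsuc j) i≢j = lookup-distinct ≠xs i j (i≢j ∘ cong fsuc)

  ⊈-line : i ≢ j → ¬ (L i ⊆ₛ L j)
  ⊈-line i≢j i⊆j = lookup-distinct distinct _ _ i≢j (i⊆j , ⊆-equal-dim (L _) (L _) i⊆j)

  same-line : (S : Subspace d) → NonZero x → x ∈ₛ S → ¬ (y ∈ₛ S) →
    Through x i → Through y i → Through x j → Through y j → i ≡ j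
  same-line {i = i} {j} S x≉0 x∈S y∉S xi yi xj yj with i Fin.≟ j
  ... | yes i≡j = i≡j
  ... | no i≢j  = ⊥-elim (⊈-line i≢j (line-⊆ (L i) S (L j) x≉0 xi yi x∈S y∉S xj yj))

  plane-count : (τ : Plane) → i ≢ j → In τ i → In τ j → count (in? τ) ≡ suc q
  plane-count τ i≢j iτ jτ with pl τ
  ... | k , cnt , cases with Count⇒count (_⊆? τ) cnt | count-pair (in? τ) _ _ iτ jτ i≢j
  plane-count τ i≢j iτ jτ | k , cnt , inj₁ refl        | eq | 2≤ = ⊥-elim (ℕ.n≮0 (subst (2 ≤_) eq 2≤))
  plane-count τ i≢j iτ jτ | k , cnt , inj₂ (inj₁ refl) | eq | 2≤ = ⊥-elim (ℕ.<-irrefl refl (subst (2 ≤_) eq 2≤))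
  plane-count τ i≢j iτ jτ | k , cnt , inj₂ (inj₂ refl) | eq | 2≤ = eq

  solid-count : (σ : Solid) → i ≢ j → In σ i → In σ j → count (in? σ) ≡ suc q ⊎ count (in? σ) ≡ suc (2 * q)
  solid-count σ i≢j iσ jσ with sd σ
  ... | k , cnt , cases with Count⇒count (_⊆? σ) cnt | count-pair (in? σ) _ _ iσ jσ i≢j
  solid-count σ i≢j iσ jσ | k , cnt , inj₁ refl               | eq | 2≤ = ⊥-elim (ℕ.n≮0 (subst (2 ≤_) eq 2≤))
  solid-count σ i≢j iσ jσ | k , cnt , inj₂ (inj₁ refl)        | eq | 2≤ = ⊥-elim (ℕ.<-irrefl refl (subst (2 ≤_) eq 2≤))
  solid-count σ i≢j iσ jσ | k , cnt , inj₂ (inj₂ (inj₁ refl)) | eq | 2≤ = inj₁ eq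
  solid-count σ i≢j iσ jσ | k , cnt , inj₂ (inj₂ (inj₂ refl)) | eq | 2≤ = inj₂ eq

  solid-count-≤ : (σ : Solid) → i ≢ j → In σ i → In σ j → count (in? σ) ≤ suc (2 * q)
  solid-count-≤ σ i≢j iσ jσ with solid-count σ i≢j iσ jσ
  ... | inj₁ eq = subst (_≤ suc (2 * q)) (sym eq) (s≤s (ℕ.m≤m+n q _))
  ... | inj₂ eq = ℕ.≤-reflexive eq

  through-count : NonZero x → Through x i → count (through? x) ≡ suc q
  through-count {x = x} {i} x≉0 xi with pt ⟨ x≉0 ⟩
  ... | k , cnt , cases = trans (ℕ.≤-antisym
          (count-mono (through? x) _ λ j xj → ⟨⟩-⊆ x≉0 (L j) xj)
          (count-mono _ (through? x) λ j x⊆j → x⊆j x (∈-⟨⟩ x≉0)))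
        (trans (Count⇒count (⟨ x≉0 ⟩ ⊆?_) cnt) (k≡ cases))
    where
    k≡ : k ≡ 0 ⊎ k ≡ suc q → k ≡ suc q
    k≡ (inj₂ eq)   = eq
    k≡ (inj₁ refl) = ⊥-elim (ℕ.n≮0 (subst (1 ≤_) (Count⇒count (⟨ x≉0 ⟩ ⊆?_) cnt)
      (count-member (λ j → ⟨ x≉0 ⟩ ⊆? L j) i (⟨⟩-⊆ x≉0 (L i) xi))))

  -- Planes and solids spanned by two lines

  plane-unique : (τ τ′ : Plane) → i ≢ j → In τ i → In τ j → In τ′ i → In τ′ j → τ′ ⊆ₛ τ
  plane-unique {i = i} {j} τ τ′ i≢j iτ jτ iτ′ jτ′ with ⊈-witness (L j) (L i) (⊈-line (i≢j ∘ sym))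
  ... | w , wj , w∉i = λ v v∈ → extend-⊆ (L i) w∉i τ iτ (jτ w wj) v
    (⊆-equal-dim (extend (L i) w w∉i) τ′ (extend-⊆ (L i) w∉i τ′ iτ′ (jτ′ w wj)) v v∈)

  -- Minimality ranges over every dimension `e`, so that it applies to ambient subspaces as well as
  -- to competing planes and solids.
  Spans : Fin b → Fin b → Subspace d → Set _
  Spans i j S = In S i × In S j × (∀ {e} (T : Subspace e) → In T i → In T j → S ⊆ₛ T)

  abstract
    plane-of : i ≢ j → NonZero x → Through x i → Through x j → Σ Plane (Spans i j)
    plane-of {i = i} {j} i≢j x≉0 xi xj with ⊈-witness (L j) (L i) (⊈-line (i≢j ∘ sym))
    ... | w , wj , w∉i = extend (L i) w w∉i , ⊆-extend (L i) w∉i ,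
      line-⊆ (L j) (L i) (extend (L i) w w∉i) x≉0 xj wj xi w∉i (⊆-extend (L i) w∉i _ xi) (∈-extend (L i) w∉i) ,
      λ T iT jT → extend-⊆ (L i) w∉i T iT (jT w wj)

    solid-of : ∀ i j → ¬ Meet (L j) (L i) → Σ Solid (Spans i j)
    solid-of i j skew = extend τ v v∉ , (λ w wi → ⊆-extend τ v∉ w (⊆-extend (L i) u∉ w wi)) ,
        generated-⊆ (L j) (extend τ v v∉) (λ { fzero → ⊆-extend τ v∉ u (∈-extend (L i) u∉) ; (fsuc fzero) → ∈-extend τ v∉ }) ,
        λ T iT jT → extend-⊆ τ v∉ T (extend-⊆ (L i) u∉ T iT (jT u (basis-∈ (L j) fzero))) (jT v (basis-∈ (L j) (fsuc fzero)))
      where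
      u v : Vector
      u = basis (L j) fzero
      v = basis (L j) (fsuc fzero)
      u∉ : ¬ (u ∈ₛ L i)
      u∉ u∈ = skew (u , point-NonZero (L j) fzero , basis-∈ (L j) fzero , u∈)
      τ : Plane
      τ = extend (L i) u u∉
      v∉ : ¬ (v ∈ₛ τ)
      v∉ v∈ = skew (meet-of-extend (L j) (L i) u∉ v∈)

  -- Pencils of lines through a point

  module _ (τ : Plane) (i≢j : i ≢ j) (iτ : In τ i) (jτ : In τ j)
           (x≉0 : NonZero x) (xi : Through x i) (xj : Through x j) where

    abstract
      -- A line k of the pencil outside τ would span with i and with j two further planes of a
      -- solid, and the three planes together hold 3q > 2q + 1 lines.
      pencil-in-plane : ∀ k → Through x k → In τ k
      pencil-in-plane k xk with in? τ k
      ... | yes kτ = kτ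
      ... | no ¬kτ with ⊈-witness (L k) τ ¬kτ
      ...   | w , wk , w∉τ = ⊥-elim (ℕ.<⇒≱ 1<q q≤1)
        where
        σ : Solid
        σ = extend τ w w∉τ
        τ⊆σ : τ ⊆ₛ σ
        τ⊆σ = ⊆-extend τ w∉τ
        kσ : In σ k
        kσ = line-⊆ (L k) τ σ x≉0 xk wk (iτ _ xi) w∉τ (τ⊆σ _ (iτ _ xi)) (∈-extend τ w∉τ)
        i≢k : i ≢ k
        i≢k refl = ¬kτ iτ
        j≢k : j ≢ k
        j≢k refl = ¬kτ jτ
        τ₁ τ₂ : Plane
        τ₁ = proj₁ (plane-of i≢k x≉0 xi xk)
        τ₂ = proj₁ (plane-of j≢k x≉0 xj xk)
        s₁ : Spans i k τ₁
        s₁ = proj₂ (plane-of i≢k x≉0 xi xk)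
        s₂ : Spans j k τ₂
        s₂ = proj₂ (plane-of j≢k x≉0 xj xk)
        iτ₁ : In τ₁ i
        iτ₁ = proj₁ s₁
        kτ₁ : In τ₁ k
        kτ₁ = proj₁ (proj₂ s₁)
        jτ₂ : In τ₂ j
        jτ₂ = proj₁ s₂
        kτ₂ : In τ₂ k
        kτ₂ = proj₁ (proj₂ s₂)
        iσ : In σ i
        iσ v v∈ = τ⊆σ v (iτ v v∈)
        jσ : In σ j
        jσ v v∈ = τ⊆σ v (jτ v v∈)
        τ₁⊆σ : τ₁ ⊆ₛ σ
        τ₁⊆σ = proj₂ (proj₂ s₁) σ iσ kσ
        τ₂⊆σ : τ₂ ⊆ₛ σ
        τ₂⊆σ = proj₂ (proj₂ s₂) σ jσ kσ
        B? : Decidable (λ h → In τ₁ h × h ≢ i)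
        B? = without? (in? τ₁) i
        C? : Decidable (λ h → (In τ₂ h × h ≢ j) × h ≢ k)
        C? = without? (without? (in? τ₂) j) k
        new? : Decidable (λ h → In σ h × ¬ In τ h)
        new? h = in? σ h ×-dec ¬? (in? τ h)
        q≤B : q ≤ count B?
        q≤B = ℕ.≤-pred (subst (_≤ 1 + count B?) (plane-count τ₁ i≢k iτ₁ kτ₁) (count-without (in? τ₁) i))
        q≤1+C : q ≤ 1 + count C?
        q≤1+C = ℕ.≤-pred (subst (_≤ 2 + count C?) (plane-count τ₂ j≢k jτ₂ kτ₂)
          (ℕ.≤-trans (count-without (in? τ₂) j) (s≤s (count-without (without? (in? τ₂) j) k))))
        ∉τ₁ : ∀ h → In τ₁ h × h ≢ i → ¬ In τ h
        ∉τ₁ h (hτ₁ , h≢i) hτ = ¬kτ λ v v∈ → plane-unique τ τ₁ h≢i hτ iτ hτ₁ iτ₁ v (kτ₁ v v∈)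
        ∉τ₂ : ∀ h → (In τ₂ h × h ≢ j) × h ≢ k → ¬ In τ h
        ∉τ₂ h ((hτ₂ , h≢j) , _) hτ = ¬kτ λ v v∈ → plane-unique τ τ₂ h≢j hτ jτ hτ₂ jτ₂ v (kτ₂ v v∈)
        disjoint : ∀ h → In τ₁ h × h ≢ i → ¬ ((In τ₂ h × h ≢ j) × h ≢ k)
        disjoint h (hτ₁ , _) ((hτ₂ , _) , h≢k) = ¬kτ λ v v∈ → plane-unique τ τ₁ i≢j iτ jτ iτ₁
          (λ v′ v′∈ → plane-unique τ₁ τ₂ h≢k hτ₁ kτ₁ hτ₂ kτ₂ v′ (jτ₂ v′ v′∈)) v (kτ₁ v v∈)
        B+C≤new : count B? + count C? ≤ count new?
        B+C≤new = count-disjoint B? C? new?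
          (λ h hB → (λ v v∈ → τ₁⊆σ v (proj₁ hB v v∈)) , ∉τ₁ h hB)
          (λ h hC → (λ v v∈ → τ₂⊆σ v (proj₁ (proj₁ hC) v v∈)) , ∉τ₂ h hC) disjoint
        total : suc q + count new? ≤ suc q + q
        total = begin
          suc q + count new?          ≡⟨ cong (_+ count new?) (plane-count τ i≢j iτ jτ) ⟨
          count (in? τ) + count new?  ≤⟨ count-disjoint (in? τ) new? (in? σ) (λ h hτ v v∈ → τ⊆σ v (hτ v v∈)) (λ _ → proj₁) (λ h hτ hn → proj₂ hn hτ) ⟩
          count (in? σ)               ≤⟨ solid-count-≤ σ i≢j iσ jσ ⟩
          suc (2 * q)                 ≡⟨ cong (λ z → suc (q + z)) (ℕ.+-identityʳ q) ⟩
          suc q + q                   ∎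
          where open ℕ.≤-Reasoning
        q≤1 : q ≤ 1
        q≤1 = ℕ.+-cancelˡ-≤ q q 1 (begin
          q + q                          ≤⟨ ℕ.+-mono-≤ q≤B q≤1+C ⟩
          count B? + (1 + count C?)      ≡⟨ ℕ.+-suc (count B?) (count C?) ⟩
          1 + (count B? + count C?)      ≤⟨ s≤s (ℕ.≤-trans B+C≤new (ℕ.+-cancelˡ-≤ (suc q) _ _ total)) ⟩
          1 + q                          ≡⟨ ℕ.+-comm 1 q ⟩
          q + 1                          ∎)
          where open ℕ.≤-Reasoning

      -- The pencil and the plane both hold q + 1 lines, so the inclusion just shown is an equality.
      plane-in-pencil : ∀ k → In τ k → Through x k
      plane-in-pencil = count-full (through? x) (in? τ) pencil-in-plane
        (ℕ.≤-reflexive (trans (plane-count τ i≢j iτ jτ) (sym (through-count x≉0 xi))))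

      -- The q + 1 lines of the pencil meet a line of τ off x in q + 1 different points.
      pencil-line : ∀ {p} → p ∈ₛ τ → ¬ (p ∈ₛ L i) → ∃[ k ] (Through x k × Through p k)
      pencil-line {p} p∈τ p∉i with Fin.any? (λ k → through? x k ×-dec through? p k)
      ... | yes found = found
      ... | no none with line-⊈-point (L i) x≉0
      ...   | z , zi , z∉x = ⊥-elim (ℕ.<⇒≱ (ℕ.n<1+n q) bound)
        where
        z≉0 : NonZero z
        z≉0 = ∉⇒NonZero ⟨ x≉0 ⟩ z∉x
        p∉z : ¬ (p ∈ₛ ⟨ z≉0 ⟩)
        p∉z p∈ = p∉i (⟨⟩-⊆ z≉0 (L i) zi p p∈)
        l : Line
        l = extend ⟨ z≉0 ⟩ p p∉z
        l⊆τ : l ⊆ₛ τ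
        l⊆τ = extend-⊆ ⟨ z≉0 ⟩ p∉z τ (⟨⟩-⊆ z≉0 τ (iτ z zi)) p∈τ
        point∉x : ∀ t → ¬ (point l (fsuc t) ∈ₛ ⟨ x≉0 ⟩)
        point∉x t r∈ = p∉i (two-points-⊆ l (L i) (fsuc t) (fsuc z-index) t≢ (⟨⟩-⊆ x≉0 (L i) xi _ r∈) zi′ p (∈-extend ⟨ z≉0 ⟩ p∉z))
          where
          -- `extend` puts `p` in front of `z`, so `p` is point `fzero` of `l`, while `z` is the
          -- normalised point with coefficient 0.
          z-index : Fin q
          z-index = index (Field.0# F)
          z≈ : z ≈ᵥ point l (fsuc z-index)
          z≈ v = FS.sym (FS.trans (FS.+-congˡ (FS.trans (FS.*-congʳ (elem-index FS.0#)) (FS.zeroˡ _))) (FS.+-identityʳ _))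
            where module FS = Field F
          zi′ : point l (fsuc z-index) ∈ₛ L i
          zi′ = ∈-resp (L i) z≈ zi
          t≢ : fsuc t ≢ fsuc z-index
          t≢ eq = z∉x (∈-resp ⟨ x≉0 ⟩ (λ v → FS.sym (z≈ v)) (subst (λ s → point l s ∈ₛ ⟨ x≉0 ⟩) eq r∈))
            where module FS = Field F
        on? : ∀ t → Decidable (λ k → Through x k × Through (point l (fsuc t)) k)
        on? t k = through? x k ×-dec through? (point l (fsuc t)) k
        -- Every line of τ meets `l`, but by assumption not at `p`. Each of the other q points
        -- differs from `x` and so carries at most one line of the pencil.
        covered : ∀ k → In τ k → ∃[ t ] (Through x k × Through (point l (fsuc t)) k)
        covered k kτ with meet-line (L k) l τ kτ l⊆τ
        ... | w , w≉0 , wk , wl with meet-at-point l (L k) (w , w≉0 , wl , wk)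
        ...   | fzero , pk  = ⊥-elim (none (k , plane-in-pencil k kτ , pk))
        ...   | fsuc t , rk = t , plane-in-pencil k kτ , rk
        bound : suc q ≤ q
        bound = begin
          suc q          ≡⟨ plane-count τ i≢j iτ jτ ⟨
          count (in? τ)  ≤⟨ count-covering on? (in? τ) (λ t → count-unique (on? t)
                              λ k k′ (xk , rk) (xk′ , rk′) → same-line ⟨ x≉0 ⟩ x≉0 (∈-⟨⟩ x≉0) (point∉x t) xk rk xk′ rk′) covered ⟩
          q * 1          ≡⟨ ℕ.*-identityʳ q ⟩
          q              ∎
          where open ℕ.≤-Reasoning

  -- Concurrent and skew lines

  Concurrent : Fin b → Fin b → Set (c ⊔ ℓ)
  Concurrent i j = i ≢ j × Meet (L i) (L j)

  concurrent? : ∀ i → Decidable (Concurrent i)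
  concurrent? i j = ¬? (i Fin.≟ j) ×-dec meet? (L i) (L j)

  concurrent-at : i ≢ j → NonZero x → Through x i → Through x j → Concurrent i j
  concurrent-at i≢j x≉0 xi xj = i≢j , _ , x≉0 , xi , xj

  concurrent-sym : Concurrent i j → Concurrent j i
  concurrent-sym (i≢j , p , p≉0 , pi , pj) = i≢j ∘ sym , p , p≉0 , pj , pi

  -- A line meets itself, so this is `Meet` with the case of equality split off.
  Near : Fin b → Fin b → Set (c ⊔ ℓ)
  Near m j = j ≡ m ⊎ Concurrent m j

  near? : ∀ m → Decidable (Near m)
  near? m j = (j Fin.≟ m) ⊎-dec concurrent? m j

  near-sym : Near i j → Near j i
  near-sym (inj₁ refl) = inj₁ refl
  near-sym (inj₂ ij)   = inj₂ (concurrent-sym ij)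

  ¬near⇒skew : ¬ Near m j → ¬ Meet (L m) (L j)
  ¬near⇒skew {m = m} {j} far meet with m Fin.≟ j
  ... | yes refl = far (inj₁ refl)
  ... | no m≢j   = far (inj₂ (m≢j , meet))

  ¬near⇒≢ : ¬ Near m j → m ≢ j
  ¬near⇒≢ far refl = far (inj₁ refl)

  -- Pencils at two points of m would fill the solid, leaving no room for i.
  concurrent-in-solid : (σ : Solid) → In σ m → In σ i → ¬ Near m i →
    In σ j → In σ k → m ≢ j → NonZero x → Through x m → Through x j → Concurrent m k → Through x k
  concurrent-in-solid {m} {i} {j} {k} {x} σ mσ iσ far jσ kσ m≢j x≉0 xm xj (m≢k , y , y≉0 , ym , yk) with through? x k
  ... | yes xk = xk
  ... | no x∉k with plane-of m≢j x≉0 xm xj | plane-of m≢k y≉0 ym yk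
  ...   | τ , mτ , jτ , τ-min | τ′ , mτ′ , kτ′ , τ′-min = ⊥-elim (ℕ.<⇒≱ (ℕ.n<1+n (suc (2 * q))) bound)
    where
    B? = without? (in? τ′) m
    AB? : Decidable (λ h → In τ h ⊎ (In τ′ h × h ≢ m))
    AB? h = in? τ h ⊎-dec B? h
    on-x : ∀ h → In τ h → Through x h
    on-x = plane-in-pencil τ m≢j mτ jτ x≉0 xm xj
    on-y : ∀ h → In τ′ h → Through y h
    on-y = plane-in-pencil τ′ m≢k mτ′ kτ′ y≉0 ym yk
    -- The line `k` contains `y` but not `x`; hence these are different points, and only `m` joins
    -- them.
    disjoint : ∀ h → In τ h → ¬ (In τ′ h × h ≢ m)
    disjoint h hτ (hτ′ , h≢m) = h≢m (same-line (L k) y≉0 yk x∉k (on-y h hτ′) (on-x h hτ) ym xm)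
    i∉AB : ¬ (In τ i ⊎ (In τ′ i × i ≢ m))
    i∉AB (inj₁ iτ)        = far (inj₂ (concurrent-at (¬near⇒≢ far) x≉0 xm (on-x i iτ)))
    i∉AB (inj₂ (iτ′ , _)) = far (inj₂ (concurrent-at (¬near⇒≢ far) y≉0 ym (on-y i iτ′)))
    AB⊆σ : ∀ h → In τ h ⊎ (In τ′ h × h ≢ m) → In σ h
    AB⊆σ h (inj₁ hτ) v v∈        = τ-min σ mσ jσ v (hτ v v∈)
    AB⊆σ h (inj₂ (hτ′ , _)) v v∈ = τ′-min σ mσ kσ v (hτ′ v v∈)
    bound : suc (suc (2 * q)) ≤ suc (2 * q)
    bound = begin
      suc (suc (2 * q))                  ≡⟨ cong (λ z → suc (suc (q + z))) (ℕ.+-identityʳ q) ⟩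
      suc (suc q + q)                    ≤⟨ s≤s (ℕ.+-mono-≤ (ℕ.≤-reflexive (sym (plane-count τ m≢j mτ jτ)))
                                             (ℕ.≤-pred (subst (_≤ 1 + count B?) (plane-count τ′ m≢k mτ′ kτ′) (count-without (in? τ′) m)))) ⟩
      suc (count (in? τ) + count B?)     ≤⟨ s≤s (count-disjoint (in? τ) B? AB? (λ _ → inj₁) (λ _ → inj₂) disjoint) ⟩
      suc (count AB?)                    ≤⟨ count-insert AB? (in? σ) AB⊆σ i iσ i∉AB ⟩
      count (in? σ)                      ≤⟨ solid-count-≤ σ (¬near⇒≢ far) mσ iσ ⟩
      suc (2 * q)                        ∎
      where open ℕ.≤-Reasoning

  -- Lines of a solid that are skew to one of its lines

  Private : Solid → Fin b → Fin b → Fin b → Set (c ⊔ ℓ)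
  Private σ m i j = In σ j × j ≢ i × ¬ Near m j

  private? : (σ : Solid) → ∀ m i → Decidable (Private σ m i)
  private? σ m i j = in? σ j ×-dec (¬? (j Fin.≟ i) ×-dec ¬? (near? m j))

  skew? : (σ : Solid) → ∀ m → Decidable (λ j → In σ j × ¬ Near m j)
  skew? σ m j = in? σ j ×-dec ¬? (near? m j)

  skew-count-≤ : (σ : Solid) → ∀ m i → count (skew? σ m) ≤ 1 + count (private? σ m i)
  skew-count-≤ σ m i = ℕ.≤-trans (count-without (skew? σ m) i)
    (s≤s (count-mono (without? (skew? σ m) i) (private? σ m i) λ { _ ((jσ , far) , j≢i) → jσ , j≢i , far }))

  -- If no line of the solid meets `m`, at least q + 1 lines remain to be reduced by `m` and `i`.
  -- Otherwise the solid contains a pencil of q + 1 lines without `i`, which forces 2q + 1 lines in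
  -- all. By `concurrent-in-solid` the q lines outside the pencil are skew to `m`, and one of them
  -- is `i`.
  private-count : (σ : Solid) → In σ m → In σ i → ¬ Near m i → Q ≤ count (private? σ m i)
  private-count {m = m} {i} σ mσ iσ far with Fin.any? (λ a → in? σ a ×-dec concurrent? m a)
  ... | no none = ℕ.≤-pred (ℕ.≤-pred (begin
      suc q                                ≤⟨ lower ⟩
      count (in? σ)                        ≤⟨ count-union (Fin._≟ m) (skew? σ m) (in? σ) split ⟩
      count (Fin._≟ m) + count (skew? σ m) ≤⟨ ℕ.+-mono-≤ (count-≡ m) (skew-count-≤ σ m i) ⟩
      2 + count (private? σ m i)           ∎))
    where
    open ℕ.≤-Reasoning
    lower : suc q ≤ count (in? σ)
    lower with solid-count σ (¬near⇒≢ far) mσ iσ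
    ... | inj₁ eq = ℕ.≤-reflexive (sym eq)
    ... | inj₂ eq = subst (suc q ≤_) (sym eq) (s≤s (ℕ.m≤m+n q _))
    split : ∀ j → In σ j → j ≡ m ⊎ (In σ j × ¬ Near m j)
    split j jσ with near? m j
    ... | yes (inj₁ j≡m) = inj₁ j≡m
    ... | yes (inj₂ mj)  = ⊥-elim (none (j , jσ , mj))
    ... | no far′        = inj₂ (jσ , far′)
  ... | yes (a , aσ , m≢a , x , x≉0 , xm , xa) with plane-of m≢a x≉0 xm xa
  ...   | τ , mτ , aτ , τ-min = ℕ.≤-pred (ℕ.≤-pred (ℕ.+-cancelˡ-≤ q _ _ (begin
      q + suc q                                   ≡⟨ ℕ.+-suc q q ⟩
      suc (q + q)                                 ≡⟨ cong (λ z → suc (q + z)) (ℕ.+-identityʳ q) ⟨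
      suc (2 * q)                                 ≡⟨ σ-count ⟨
      count (in? σ)                               ≤⟨ count-union (in? τ) (skew? σ m) (in? σ) split ⟩
      count (in? τ) + count (skew? σ m)           ≤⟨ ℕ.+-mono-≤ (ℕ.≤-reflexive (plane-count τ m≢a mτ aτ)) (skew-count-≤ σ m i) ⟩
      suc q + (1 + count (private? σ m i))        ≡⟨ ℕ.+-suc q _ ⟨
      q + (2 + count (private? σ m i))            ∎)))
    where
    open ℕ.≤-Reasoning
    τ⊆σ : ∀ h → In τ h → In σ h
    τ⊆σ h hτ v v∈ = τ-min σ mσ aσ v (hτ v v∈)
    i∉τ : ¬ In τ i
    i∉τ iτ = far (inj₂ (concurrent-at (¬near⇒≢ far) x≉0 xm (plane-in-pencil τ m≢a mτ aτ x≉0 xm xa i iτ)))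
    σ-count : count (in? σ) ≡ suc (2 * q)
    σ-count with solid-count σ (¬near⇒≢ far) mσ iσ
    ... | inj₂ eq = eq
    ... | inj₁ eq = ⊥-elim (ℕ.<-irrefl (trans (plane-count τ m≢a mτ aτ) (sym eq)) (count-insert (in? τ) (in? σ) τ⊆σ i iσ i∉τ))
    split : ∀ j → In σ j → In τ j ⊎ (In σ j × ¬ Near m j)
    split j jσ with near? m j
    ... | yes (inj₁ refl) = inj₁ mτ
    ... | yes (inj₂ mj)   = inj₁ (pencil-in-plane τ m≢a mτ aτ x≉0 xm xa j
                              (concurrent-in-solid σ mσ iσ far aσ jσ m≢a x≉0 xm xa mj))
    ... | no far′         = inj₂ (jσ , far′)

  -- The lines `i` and `j` must be coplanar, as otherwise the whole solid, and `m` with it, would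
  -- lie in `W`. The line `m` meets their plane in a point `p`, and the pencil at the common point
  -- of `i` and `j` has a line through `p`: the transversal `k`.
  trace-of-solid : (W : Subspace d) (σ : Solid) → In σ m → In σ i → In W i → ¬ In W m → ¬ Near m i →
    In W j → In σ j → j ≢ i → ∃[ k ] (In W k × Concurrent k m × Concurrent k i)
  trace-of-solid {m = m} {i} {j} W σ mσ iσ iW m∉W far jW jσ j≢i with ⊈-witness (L j) (L i) (⊈-line j≢i)
  ... | w , wj , w∉i = result
    where
    τ : Plane
    τ = extend (L i) w w∉i
    τ⊆W : τ ⊆ₛ W
    τ⊆W = extend-⊆ (L i) w∉i W iW (jW w wj)
    τ⊆σ : τ ⊆ₛ σ
    τ⊆σ = extend-⊆ (L i) w∉i σ iσ (jσ w wj)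
    iτ : In τ i
    iτ = ⊆-extend (L i) w∉i
    jτ : In τ j
    jτ with in? τ j
    ... | yes jτ = jτ
    ... | no j∉τ with ⊈-witness (L j) τ j∉τ
    ...   | v , vj , v∉τ = ⊥-elim (m∉W λ u u∈ → extend-⊆ τ v∉τ W τ⊆W (jW v vj) u
              (⊆-equal-dim (extend τ v v∉τ) σ (extend-⊆ τ v∉τ σ τ⊆σ (jσ v vj)) u (mσ u u∈)))
    result : ∃[ k ] (In W k × Concurrent k m × Concurrent k i)
    result with meet-line (L j) (L i) τ jτ iτ | meet-line (L m) τ σ mσ τ⊆σ
    ... | x , x≉0 , xj , xi | p , p≉0 , pm , pτ
        with pencil-line τ (j≢i ∘ sym) iτ jτ x≉0 xi xj pτ (λ pi → far (inj₂ (concurrent-at (¬near⇒≢ far) p≉0 pm pi)))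
    ...   | k , xk , pk = k , kW , concurrent-at (λ { refl → m∉W kW }) p≉0 pk pm , concurrent-at k≢i x≉0 xk xi
      where
      kW : In W k
      kW v v∈ = τ⊆W v (pencil-in-plane τ (j≢i ∘ sym) iτ jτ x≉0 xi xj k xk v v∈)
      k≢i : k ≢ i
      k≢i refl = far (inj₂ (concurrent-at (¬near⇒≢ far) p≉0 pm pk))

  -- The number of lines meeting a given line

  concurrent-count-≥ : ∀ i → suc q * q ≤ count (concurrent? i)
  concurrent-count-≥ i = ℕ.≤-trans (ℕ.*-monoˡ-≤ q (count-all {P = λ (_ : Fin (suc q)) → ⊤} (λ _ → yes tt) (λ _ → tt)))
    (count-packing (λ _ → yes tt) (λ t → without? (through? (point (L i) t)) i) (concurrent? i)
      (λ t _ → ℕ.≤-pred (subst (_≤ 1 + count (without? (through? (point (L i) t)) i))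
        (through-count (point-NonZero (L i) t) (point-∈ (L i) t)) (count-without (through? (point (L i) t)) i)))
      (λ t j _ (tj , j≢i) → concurrent-at (j≢i ∘ sym) (point-NonZero (L i) t) (point-∈ (L i) t) tj)
      disjoint)
    where
    disjoint : ∀ s t j → ⊤ → ⊤ → Through (point (L i) s) j × j ≢ i → Through (point (L i) t) j × j ≢ i → s ≡ t
    disjoint s t j _ _ (sj , j≢i) (tj , _) with s Fin.≟ t
    ... | yes s≡t = s≡t
    ... | no s≢t  = ⊥-elim (⊈-line (j≢i ∘ sym) (two-points-⊆ (L i) (L j) s t s≢t sj tj))

  concurrent-count-≤ : ∀ i → count (concurrent? i) ≤ suc q * q
  concurrent-count-≤ i = count-covering (λ t → without? (through? (point (L i) t)) i) (concurrent? i)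
      (λ t → ℕ.≤-pred (subst (suc (count (without? (through? (point (L i) t)) i)) ≤_)
        (through-count (point-NonZero (L i) t) (point-∈ (L i) t))
        (count-insert (without? (through? (point (L i) t)) i) (through? (point (L i) t)) (λ _ → proj₁) i (point-∈ (L i) t) λ r → proj₂ r refl)))
      cov
    where
    cov : ∀ j → Concurrent i j → ∃[ t ] (Through (point (L i) t) j × j ≢ i)
    cov j (i≢j , meet) with meet-at-point (L i) (L j) meet
    ... | t , tj = t , tj , i≢j ∘ sym

  -- Growth caused by a line outside a subspace

  Between : Fin b → Fin b → Fin b → Set (c ⊔ ℓ)
  Between m i j = Σ (¬ Meet (L m) (L i)) λ skew → Private (proj₁ (solid-of i m skew)) m i j

  -- The solid returned by `solid-of` depends on the proof of skewness; minimality of the span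
  -- carries membership from the solid of one proof to that of another.
  between? : ∀ m i → Decidable (Between m i)
  between? m i j with meet? (L m) (L i)
  ... | yes meet = no λ (skew , _) → skew meet
  ... | no skew  = map′ (skew ,_)
    (λ (skew′ , jσ′ , r) → (λ v v∈ → proj₂ (proj₂ (proj₂ (solid-of i m skew′))) σ
      (proj₁ (proj₂ (solid-of i m skew))) (proj₁ (proj₂ (proj₂ (solid-of i m skew)))) v (jσ′ v v∈)) , r)
    (private? σ m i j)
    where
    σ : Solid
    σ = proj₁ (solid-of i m skew)

  -- Every good line i of W contributes its own set of at least q − 1 lines of the solid ⟨i , m⟩.
  growth : ∀ {p g} (W : Subspace d) {X : Fin b → Set p} (X? : Decidable X) {G : Fin b → Set g} (G? : Decidable G) →
    ∀ m → ¬ In W m → (∀ j → In W j → X j) →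
    (∀ i → G i → In W i × ¬ Near m i × (∀ k → In W k → Concurrent k m → ¬ Concurrent k i)) →
    (∀ i → G i → (σ : Solid) → Spans i m σ → ∀ j → In σ j → X j) →
    count (in? W) + (count (λ j → X? j ×-dec (¬? (in? W j) ×-dec near? m j)) + count G? * Q) ≤ count X?
  growth W {X} X? {G} G? m m∉W W⊆X good closed = ℕ.≤-trans
      (ℕ.+-monoʳ-≤ (count (in? W)) (ℕ.≤-trans
        (ℕ.+-monoʳ-≤ (count fresh?) (count-packing G? (between? m) far? large sub disj))
        (count-disjoint fresh? far? new? (λ { _ (x , w , _) → x , w }) (λ { _ (x , w , _) → x , w }) λ { _ (_ , _ , nr) (_ , _ , fr) → fr nr })))
      (count-disjoint (in? W) new? X? W⊆X (λ _ → proj₁) (λ _ jW r → proj₂ r jW))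
    where
    -- The solids contribute only lines skew to `m`, so the new lines near `m` can be counted in
    -- addition.
    fresh? : Decidable (λ j → X j × (¬ In W j × Near m j))
    fresh? j = X? j ×-dec (¬? (in? W j) ×-dec near? m j)
    far? : Decidable (λ j → X j × (¬ In W j × ¬ Near m j))
    far? j = X? j ×-dec (¬? (in? W j) ×-dec ¬? (near? m j))
    new? : Decidable (λ j → X j × ¬ In W j)
    new? j = X? j ×-dec ¬? (in? W j)
    large : ∀ i → G i → Q ≤ count (between? m i)
    large i g = ℕ.≤-trans (private-count σ mσ iσ far) (count-mono (private? σ m i) (between? m i) λ _ r → skew , r)
      where
      far = proj₁ (proj₂ (good i g))
      skew = ¬near⇒skew far
      σ = proj₁ (solid-of i m skew)
      iσ = proj₁ (proj₂ (solid-of i m skew))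
      mσ = proj₁ (proj₂ (proj₂ (solid-of i m skew)))
    alone : ∀ i → G i → (σ : Solid) → In σ i → In σ m → ∀ j → In W j → In σ j → j ≡ i
    alone i g σ iσ mσ j jW jσ with j Fin.≟ i
    ... | yes j≡i = j≡i
    ... | no j≢i  = ⊥-elim (none (trace-of-solid W σ mσ iσ (proj₁ (good i g)) m∉W (proj₁ (proj₂ (good i g))) jW jσ j≢i))
      where
      none : ¬ (∃[ k ] (In W k × Concurrent k m × Concurrent k i))
      none (k , kW , km , ki) = proj₂ (proj₂ (good i g)) k kW km ki
    sub : ∀ i j → G i → Between m i j → X j × (¬ In W j × ¬ Near m j)
    sub i j g (skew , jσ , j≢i , far) =
      closed i g σ spans j jσ , (λ jW → j≢i (alone i g σ (proj₁ spans) (proj₁ (proj₂ spans)) j jW jσ)) , far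
      where
      σ : Solid
      σ = proj₁ (solid-of i m skew)
      spans : Spans i m σ
      spans = proj₂ (solid-of i m skew)
    -- As `j` is skew to `m`, the solid `ρ` spanned by `j` and `m` equals both solids. Hence `i`
    -- lies in the solid of `i′`, where `alone` identifies them.
    disj : ∀ i i′ j → G i → G i′ → Between m i j → Between m i′ j → i ≡ i′
    disj i i′ j g g′ (skew , jσ , _ , far) (skew′ , jσ′ , _ , _) =
      alone i′ g′ σ′ (proj₁ spans′) mσ′ i (proj₁ (good i g)) λ v v∈ →
        ρ-min σ′ jσ′ mσ′ v (⊆-equal-dim ρ σ (ρ-min σ jσ (proj₁ (proj₂ spans))) v (proj₁ spans v v∈))
      where
      σ σ′ ρ : Solid
      σ = proj₁ (solid-of i m skew)
      σ′ = proj₁ (solid-of i′ m skew′)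
      ρ = proj₁ (solid-of j m (¬near⇒skew far))
      spans : Spans i m σ
      spans = proj₂ (solid-of i m skew)
      spans′ : Spans i′ m σ′
      spans′ = proj₂ (solid-of i′ m skew′)
      mσ′ : In σ′ m
      mσ′ = proj₁ (proj₂ spans′)
      ρ-min : (T : Subspace 4) → In T j → In T m → ρ ⊆ₛ T
      ρ-min = proj₂ (proj₂ (proj₂ (solid-of j m (¬near⇒skew far))))

  -- Excluded quadrangles and triangles

  no-quadrangle : ∀ {a a′} → ¬ Near i k → Concurrent i a → Concurrent i a′ → Concurrent a k → Concurrent a′ k → a ≡ a′
  no-quadrangle {i = i} {k} {a} {a′} far ia@(i≢a , x , x≉0 , xi , xa) ia′@(_ , x′ , x′≉0 , x′i , x′a′)
    ak@(a≢k , y , y≉0 , ya , yk) a′k@(_ , y′ , y′≉0 , y′a′ , y′k) =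
    -- In the solid of `i` and `k` all lines meeting `i` do so at one point, and likewise for `k`;
    -- both `a` and `a′` join these two points.
    same-line (L i) x≉0 xi (off-i yk y≉0) xa ya
      (concurrent-in-solid σ iσ kσ far aσ a′σ i≢a x≉0 xi xa ia′)
      (concurrent-in-solid σ kσ iσ (far ∘ near-sym) aσ a′σ (a≢k ∘ sym) y≉0 yk ya (concurrent-sym a′k))
    where
    σ : Solid
    σ = proj₁ (solid-of i k (¬near⇒skew (far ∘ near-sym)))
    iσ : In σ i
    iσ = proj₁ (proj₂ (solid-of i k (¬near⇒skew (far ∘ near-sym))))
    kσ : In σ k
    kσ = proj₁ (proj₂ (proj₂ (solid-of i k (¬near⇒skew (far ∘ near-sym)))))
    off-i : ∀ {z} → Through z k → NonZero z → ¬ Through z i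
    off-i zk z≉0 zi = ¬near⇒skew far (_ , z≉0 , zi , zk)
    aσ : In σ a
    aσ = line-⊆ (L a) (L i) σ x≉0 xa ya xi (off-i yk y≉0) (iσ _ xi) (kσ _ yk)
    a′σ : In σ a′
    a′σ = line-⊆ (L a′) (L i) σ x′≉0 x′a′ y′a′ x′i (off-i y′k y′≉0) (iσ _ x′i) (kσ _ y′k)

  -- If `k` meets `j` at a point of `i`, it belongs to the pencil there. Otherwise it has two
  -- different points in the plane.
  no-triangle : (τ : Plane) → In τ i → In τ j → i ≢ j → NonZero x → Through x i → Through x j →
    ∀ k → Concurrent j k → Near i k → In τ k
  no-triangle τ iτ jτ i≢j x≉0 xi xj k jk (inj₁ refl) = iτ
  no-triangle {i = i} {j} τ iτ jτ i≢j x≉0 xi xj k (_ , y , y≉0 , yj , yk) (inj₂ (_ , z , z≉0 , zi , zk)) with through? y i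
  ... | no y∉i  = line-⊆ (L k) (L i) τ z≉0 zk yk zi y∉i (iτ _ zi) (jτ _ yj)
  ... | yes yi  = pencil-in-plane τ i≢j iτ jτ y≉0 yi yj k yk

  Far : Fin b → Fin b → Fin b → Set (c ⊔ ℓ)
  Far i a k = Concurrent a k × ¬ Near i k

  far? : ∀ i a → Decidable (Far i a)
  far? i a k = concurrent? a k ×-dec ¬? (near? i k)

  -- Of the at least q + q² lines meeting `j`, those near `i` lie in the plane of `i` and `j`, which
  -- holds only q lines besides `j`.
  far-count : Concurrent i j → q * q ≤ count (far? i j)
  far-count {i = i} {j} (i≢j , x , x≉0 , xi , xj) = ℕ.+-cancelˡ-≤ q _ _ (begin
      q + q * q                            ≤⟨ concurrent-count-≥ j ⟩
      count (concurrent? j)                ≤⟨ count-union B? (far? i j) (concurrent? j) split ⟩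
      count B? + count (far? i j)          ≤⟨ ℕ.+-monoˡ-≤ _ B≤q ⟩
      q + count (far? i j)                 ∎)
    where
    open ℕ.≤-Reasoning
    τ : Plane
    τ = proj₁ (plane-of i≢j x≉0 xi xj)
    iτ : In τ i
    iτ = proj₁ (proj₂ (plane-of i≢j x≉0 xi xj))
    jτ : In τ j
    jτ = proj₁ (proj₂ (proj₂ (plane-of i≢j x≉0 xi xj)))
    B? : Decidable (λ k → Concurrent j k × Near i k)
    B? k = concurrent? j k ×-dec near? i k
    B≤q : count B? ≤ q
    B≤q = ℕ.≤-pred (subst (suc (count B?) ≤_) (plane-count τ i≢j iτ jτ)
      (count-insert B? (in? τ) (λ k (jk , ik) → no-triangle τ iτ jτ i≢j x≉0 xi xj k jk ik) j jτ λ (jj , _) → proj₁ jj refl))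
    split : ∀ k → Concurrent j k → (Concurrent j k × Near i k) ⊎ Far i j k
    split k jk with near? i k
    ... | yes ik = inj₁ (jk , ik)
    ... | no far = inj₂ (jk , far)

  -- Subspaces closed under concurrency

  Closed : Subspace d → Set (c ⊔ ℓ)
  Closed W = ∀ i j → In W i → Concurrent i j → In W j

  near-count : ∀ i → suc (suc q * q) ≤ count (near? i)
  near-count i = ℕ.≤-trans (s≤s (concurrent-count-≥ i))
    (count-insert (concurrent? i) (near? i) (λ _ → inj₂) i (inj₁ refl) λ ii → proj₁ ii refl)

  -- Two layers around `i`: the lines near it, then q² further lines beyond each line that meets it.
  -- By `no-quadrangle` no line of the second layer is counted twice.
  closed-count : (W : Subspace d) → Closed W → In W i →
    suc (suc q * q) + (suc q * q) * (q * q) ≤ count (in? W)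
  closed-count {i = i} W closed iW = begin
      suc (suc q * q) + (suc q * q) * (q * q)        ≤⟨ ℕ.+-mono-≤ (near-count i) (ℕ.*-monoˡ-≤ (q * q) (concurrent-count-≥ i)) ⟩
      count (near? i) + count (concurrent? i) * (q * q)  ≤⟨ ℕ.+-monoʳ-≤ (count (near? i)) (count-packing (concurrent? i) (far? i) rest? (λ _ → far-count) sub disj) ⟩
      count (near? i) + count rest?                  ≤⟨ count-disjoint (near? i) rest? (in? W) near⊆W (λ _ → proj₁) (λ _ near r → proj₂ r near) ⟩
      count (in? W)                                  ∎
    where
    open ℕ.≤-Reasoning
    rest? : Decidable (λ k → In W k × ¬ Near i k)
    rest? k = in? W k ×-dec ¬? (near? i k)
    near⊆W : ∀ k → Near i k → In W k
    near⊆W k (inj₁ refl) = iW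
    near⊆W k (inj₂ ik)   = closed i k iW ik
    sub : ∀ a k → Concurrent i a → Far i a k → In W k × ¬ Near i k
    sub a k ia (ak , far) = closed a k (closed i a iW ia) ak , far
    disj : ∀ a a′ k → Concurrent i a → Concurrent i a′ → Far i a k → Far i a′ k → a ≡ a′
    disj a a′ k ia ia′ (ak , far) (a′k , _) = no-quadrangle far ia ia′ ak a′k

  bound : ℕ
  bound = q ^ 5 + q ^ 4 + q ^ 3 + q ^ 2 + q + 1

  -- No line of `W` meets an outside line `m`, so every line of `W` is good for `growth`. If `W`
  -- holds a lines, there are at least q·a + 1 + q + q² in all, which exceeds `bound` by at least q
  -- + q².
  closed-contains-all : b ≤ bound → (W : Subspace d) → Closed W → In W i → ∀ m → In W m
  closed-contains-all {i = i} to W closed iW m with in? W m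
  ... | yes mW = mW
  ... | no m∉W = ⊥-elim (ℕ.<⇒≱ too-many to)
    where
    open ℕ.≤-Reasoning
    all? : Decidable (λ (_ : Fin b) → ⊤)
    all? _ = yes tt
    isolated : ∀ k → In W k → ¬ Concurrent k m
    isolated k kW km = m∉W (closed k m kW km)
    fresh? : Decidable (λ j → ⊤ × (¬ In W j × Near m j))
    fresh? j = all? j ×-dec (¬? (in? W j) ×-dec near? m j)
    near∉W : ∀ k → Near m k → ¬ In W k
    near∉W k (inj₁ refl) kW = m∉W kW
    near∉W k (inj₂ mk)   kW = isolated k kW (concurrent-sym mk)
    a = count (in? W)
    C = suc q * q
    grow : a + (count fresh? + a * Q) ≤ count all?
    grow = growth W all? (in? W) m m∉W (λ _ _ → tt)
      (λ k kW → kW , (λ mk → near∉W k mk kW) , λ h hW hm _ → isolated h hW hm)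
      (λ _ _ _ _ _ _ → tt)
    polynomial : ∀ z → 1 + (z ^ 5 + z ^ 4 + z ^ 3 + z ^ 2 + z + 1) + (z + z * z) ≡
                       z * (suc (z + z * z) + (z + z * z) * (z * z)) + suc (z + z * z) + 1
    polynomial = solve 1 (λ z → con 1 :+ (z :^ 5 :+ z :^ 4 :+ z :^ 3 :+ z :^ 2 :+ z :+ con 1) :+ (z :+ z :* z) :=
                       z :* (con 1 :+ (z :+ z :* z) :+ (z :+ z :* z) :* (z :* z)) :+ (con 1 :+ (z :+ z :* z)) :+ con 1) refl
      where open +-*-Solver
    too-many : bound < b
    too-many = ℕ.+-cancelʳ-≤ 1 _ _ (begin
      suc bound + 1                       ≤⟨ ℕ.+-monoʳ-≤ (suc bound) (s≤s z≤n) ⟩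
      suc bound + C                       ≡⟨ polynomial q ⟩
      q * (suc C + C * (q * q)) + suc C + 1  ≤⟨ ℕ.+-monoˡ-≤ 1 (ℕ.+-mono-≤ (ℕ.*-monoʳ-≤ q (closed-count W closed iW)) (near-count m)) ⟩
      q * a + count (near? m) + 1         ≤⟨ ℕ.+-monoˡ-≤ 1 (ℕ.+-monoʳ-≤ (q * a) (count-mono (near? m) fresh? λ k mk → tt , near∉W k mk , mk)) ⟩
      q * a + count fresh? + 1            ≡⟨ cong (_+ 1) rearrange ⟩
      a + (count fresh? + a * Q) + 1      ≤⟨ ℕ.+-monoˡ-≤ 1 (ℕ.≤-trans grow (count-≤n all?)) ⟩
      b + 1                               ∎)
      where
      rearrange : q * a + count fresh? ≡ a + (count fresh? + a * Q)
      rearrange = trans (ℕ.+-assoc a (Q * a) _) (cong (a +_) (trans (ℕ.+-comm (Q * a) _) (cong (count fresh? +_) (ℕ.*-comm Q a))))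

  -- Passing to the next dimension

  degree : Subspace d → Fin b → ℕ
  degree W i = count (λ j → in? W j ×-dec concurrent? i j)

  extend-by : (W : Subspace d) → In W k → ¬ In W m → Concurrent k m → Σ (Subspace (suc d)) λ X →
    In X m × q ≤ degree X m ×
    count (in? W) + (degree X m + count (λ j → in? W j ×-dec ¬? (near? k j)) * Q) ≤ count (in? X)
  extend-by {k = k} {m} W kW m∉W km@(k≢m , x , x≉0 , xk , xm) = X , mX , q≤degree ,
      ℕ.≤-trans (ℕ.+-monoʳ-≤ (count (in? W)) (ℕ.+-monoˡ-≤ _ degree≤fresh))
        (growth W (in? X) G? m m∉W W⊆X good λ i g σ (_ , _ , σ-min) j jσ v v∈ → σ-min X (W⊆X i (proj₁ g)) mX v (jσ v v∈))
    where
    open ℕ.≤-Reasoning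
    w = proj₁ (⊈-witness (L m) W m∉W)
    w∈m = proj₁ (proj₂ (⊈-witness (L m) W m∉W))
    w∉W = proj₂ (proj₂ (⊈-witness (L m) W m∉W))
    X = extend W w w∉W
    W⊆X : ∀ j → In W j → In X j
    W⊆X j jW v v∈ = ⊆-extend W w∉W v (jW v v∈)
    mX : In X m
    mX = line-⊆ (L m) W X x≉0 xm w∈m (kW x xk) w∉W (W⊆X k kW x xk) (∈-extend W w∉W)
    τ : Plane
    τ = proj₁ (plane-of k≢m x≉0 xk xm)
    kτ : In τ k
    kτ = proj₁ (proj₂ (plane-of k≢m x≉0 xk xm))
    mτ : In τ m
    mτ = proj₁ (proj₂ (proj₂ (plane-of k≢m x≉0 xk xm)))
    τ⊆X : τ ⊆ₛ X
    τ⊆X = proj₂ (proj₂ (proj₂ (plane-of k≢m x≉0 xk xm))) X (W⊆X k kW) mX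
    neighbour? : Decidable (λ j → In X j × Concurrent m j)
    neighbour? j = in? X j ×-dec concurrent? m j
    q≤degree : q ≤ degree X m
    q≤degree = ℕ.≤-pred (begin
      suc q                             ≡⟨ plane-count τ k≢m kτ mτ ⟨
      count (in? τ)                     ≤⟨ count-without (in? τ) m ⟩
      suc (count (without? (in? τ) m))  ≤⟨ s≤s (count-mono (without? (in? τ) m) neighbour? λ j (jτ , j≢m) →
                                             (λ v v∈ → τ⊆X v (jτ v v∈)) ,
                                             concurrent-at (j≢m ∘ sym) x≉0 xm (plane-in-pencil τ k≢m kτ mτ x≉0 xk xm j jτ)) ⟩
      suc (degree X m)                  ∎)
    -- A second line of `W` meeting `m` would force `m` into `W`: it either spans with `k` the plane
    -- of a pencil containing `m`, or gives `m` a second point in `W`.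
    only-k : ∀ j → In W j → Concurrent j m → j ≡ k
    only-k j jW (j≢m , y , y≉0 , yj , ym) with j Fin.≟ k
    ... | yes j≡k = j≡k
    ... | no j≢k with through? y k
    ...   | yes yk = ⊥-elim (m∉W λ v v∈ → proj₂ (proj₂ (proj₂ (plane-of j≢k y≉0 yj yk))) W jW kW v
              (pencil-in-plane (proj₁ (plane-of j≢k y≉0 yj yk)) j≢k (proj₁ (proj₂ (plane-of j≢k y≉0 yj yk)))
                (proj₁ (proj₂ (proj₂ (plane-of j≢k y≉0 yj yk)))) y≉0 yj yk m ym v v∈))
    ...   | no y∉k = ⊥-elim (m∉W (line-⊆ (L m) (L k) W x≉0 xm ym xk y∉k (kW x xk) (jW y yj)))
    G? : Decidable (λ j → In W j × ¬ Near k j)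
    G? j = in? W j ×-dec ¬? (near? k j)
    good : ∀ i → In W i × ¬ Near k i → In W i × ¬ Near m i × (∀ h → In W h → Concurrent h m → ¬ Concurrent h i)
    good i (iW , far) = iW , far-m , λ h hW hm hi → far (inj₂ (subst (λ z → Concurrent z i) (only-k h hW hm) hi))
      where
      far-m : ¬ Near m i
      far-m (inj₁ refl) = m∉W iW
      far-m (inj₂ mi)   = far (inj₁ (only-k i iW (concurrent-sym mi)))
    near-m? : Decidable (λ j → In X j × Near m j)
    near-m? j = in? X j ×-dec near? m j
    fresh? : Decidable (λ j → In X j × (¬ In W j × Near m j))
    fresh? j = in? X j ×-dec (¬? (in? W j) ×-dec near? m j)
    split : ∀ j → In X j × Near m j → j ≡ k ⊎ (In X j × (¬ In W j × Near m j))
    split j (jX , mj) with in? W j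
    ... | no j∉W = inj₂ (jX , j∉W , mj)
    ... | yes jW with mj
    ...   | inj₁ refl = ⊥-elim (m∉W jW)
    ...   | inj₂ mj′  = inj₁ (only-k j jW (concurrent-sym mj′))
    -- Two corrections cancel: `k` is a neighbour of `m` that is not fresh, and `m` is fresh without
    -- being its own neighbour.
    degree≤fresh : degree X m ≤ count fresh?
    degree≤fresh = ℕ.≤-pred (begin
      suc (degree X m)                     ≤⟨ count-insert neighbour? near-m? (λ _ (jX , mj) → jX , inj₂ mj) m (mX , inj₁ refl) (λ r → proj₁ (proj₂ r) refl) ⟩
      count near-m?                        ≤⟨ count-union (Fin._≟ k) fresh? near-m? split ⟩
      count (Fin._≟ k) + count fresh?      ≤⟨ ℕ.+-monoˡ-≤ _ (count-≡ k) ⟩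
      1 + count fresh?                     ∎)

  -- threshold t = 1 + q + ⋯ + q ^ (t − 1), so that threshold 6 is the bound of (To).
  threshold : ℕ → ℕ
  threshold zero    = 0
  threshold (suc t) = suc (q * threshold t)

  -- The shape of this invariant is forced by extend-by: it turns into
  -- threshold (t + 1) + degree X m ≤ count (in? X) one dimension higher.
  Large : ℕ → Subspace d → Fin b → Set
  Large t W m = q * threshold t + Q * degree W m + q ≤ q * count (in? W)

  large-step : ∀ t (W : Subspace d) → In W k → ¬ In W m → Concurrent k m → Large t W k →
    Σ (Subspace (suc d)) λ X → In X m × Large (suc t) X m
  large-step {k = k} {m} t W kW m∉W km large = X , proj₁ (proj₂ ext) , (begin
      -- In q · δ = Q · δ + δ the spare δ is at least q and pays for the last summand of `Large`.
      q * threshold (suc t) + Q * δ + q          ≤⟨ ℕ.+-monoʳ-≤ (q * threshold (suc t) + Q * δ) (proj₁ (proj₂ (proj₂ ext))) ⟩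
      q * threshold (suc t) + Q * δ + δ          ≡⟨ trans (ℕ.+-assoc (q * threshold (suc t)) (Q * δ) δ) (trans (cong (q * threshold (suc t) +_) (ℕ.+-comm (Q * δ) δ)) (sym (ℕ.*-distribˡ-+ q (threshold (suc t)) δ))) ⟩
      q * (threshold (suc t) + δ)                ≤⟨ ℕ.*-monoʳ-≤ q more ⟩
      q * count (in? X)                          ∎)
    where
    open ℕ.≤-Reasoning
    ext = extend-by W kW m∉W km
    X = proj₁ ext
    δ = degree X m
    a = count (in? W)
    g = degree W k
    G? : Decidable (λ j → In W j × ¬ Near k j)
    G? j = in? W j ×-dec ¬? (near? k j)
    neighbour? : Decidable (λ j → In W j × Concurrent k j)
    neighbour? j = in? W j ×-dec concurrent? k j
    rest? : Decidable (λ j → In W j × j ≢ k)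
    rest? = without? (in? W) k
    split : ∀ j → In W j × j ≢ k → (In W j × Concurrent k j) ⊎ (In W j × ¬ Near k j)
    split j (jW , j≢k) with near? k j
    ... | no far         = inj₂ (jW , far)
    ... | yes (inj₁ j≡k) = ⊥-elim (j≢k j≡k)
    ... | yes (inj₂ kj)  = inj₁ (jW , kj)
    a≤ : a ≤ 1 + (g + count G?)
    a≤ = ℕ.≤-trans (count-without (in? W) k) (s≤s (count-union neighbour? G? rest? split))
    -- With at least a - 1 - g lines skew to `k`, the right side is at least q · a - Q · g - Q. By
    -- `Large` this is at least q · threshold t + q - Q, and q - Q = 1 completes the next threshold.
    key : suc (q * threshold t) ≤ a + count G? * Q
    key = ℕ.+-cancelʳ-≤ (Q * g + Q) _ _ (begin
      suc (q * threshold t) + (Q * g + Q)      ≡⟨ solve 3 (λ u v w → con 1 :+ u :+ (v :+ w) := u :+ v :+ (con 1 :+ w)) refl (q * threshold t) (Q * g) Q ⟩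
      q * threshold t + Q * g + q              ≤⟨ large ⟩
      a + Q * a                                ≤⟨ ℕ.+-monoʳ-≤ a (ℕ.*-monoʳ-≤ Q a≤) ⟩
      a + Q * (1 + (g + count G?))             ≡⟨ solve 4 (λ a Q g G → a :+ Q :* (con 1 :+ (g :+ G)) := a :+ G :* Q :+ (Q :* g :+ Q)) refl a Q g (count G?) ⟩
      a + count G? * Q + (Q * g + Q)           ∎)
      where open +-*-Solver
    more : threshold (suc t) + δ ≤ count (in? X)
    more = begin
      suc (q * threshold t) + δ       ≤⟨ ℕ.+-monoˡ-≤ δ key ⟩
      a + count G? * Q + δ            ≡⟨ trans (ℕ.+-assoc a _ δ) (cong (a +_) (ℕ.+-comm _ δ)) ⟩
      a + (δ + count G? * Q)          ≤⟨ proj₂ (proj₂ (proj₂ ext)) ⟩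
      count (in? X)                   ∎

  -- Iteration and conclusion

  Leaves : Subspace d → Fin b → Fin b → Set (c ⊔ ℓ)
  Leaves W i j = Concurrent i j × ¬ In W j

  leaves? : (W : Subspace d) → ∀ i → Dec (∃ (Leaves W i))
  leaves? W i = Fin.any? λ j → concurrent? i j ×-dec ¬? (in? W j)

  stays : (W : Subspace d) → ¬ ∃ (Leaves W i) → ∀ j → Concurrent i j → In W j
  stays W none j ij with in? W j
  ... | yes jW = jW
  ... | no j∉W = ⊥-elim (none (j , ij , j∉W))

  -- `Large` is tied to the line `m`, but `W` may be left only from another line `i`. In that case
  -- all lines meeting `m` lie in `W`, so `m` has the greatest possible degree q + q², and the
  -- inequality for `m` implies the one for `i`.
  exit : ∀ t (W : Subspace d) → In W m → Large t W m →
    Closed W ⊎ ∃[ i ] ∃[ j ] (In W i × Leaves W i j × Large t W i)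
  exit {m = m} t W mW large with leaves? W m
  ... | yes (j , out) = inj₂ (m , j , mW , out , large)
  ... | no none with Fin.any? (λ i → in? W i ×-dec leaves? W i)
  ...   | no none′ = inj₁ λ i j iW ij → stays W (λ out → none′ (i , iW , out)) j ij
  ...   | yes (i , iW , j , out) = inj₂ (i , j , iW , out , ℕ.≤-trans
          (ℕ.+-monoˡ-≤ q (ℕ.+-monoʳ-≤ (q * threshold t) (ℕ.*-monoʳ-≤ Q degree≤))) large)
    where
    open ℕ.≤-Reasoning
    degree≤ : degree W i ≤ degree W m
    degree≤ = begin
      degree W i             ≤⟨ count-mono (λ j → in? W j ×-dec concurrent? i j) (concurrent? i) (λ _ → proj₂) ⟩
      count (concurrent? i)  ≤⟨ concurrent-count-≤ i ⟩
      suc q * q              ≤⟨ concurrent-count-≥ m ⟩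
      count (concurrent? m)  ≤⟨ count-mono (concurrent? m) (λ j → in? W j ×-dec concurrent? m j) (λ j mj → stays W none j mj , mj) ⟩
      degree W m             ∎

  too-large : b ≤ bound → (W : Subspace d) → ¬ Large 6 W m
  too-large {m = m} to W large = ℕ.<⇒≱ (ℕ.*-cancelˡ-≤ q (begin
      q * suc bound                             ≡⟨ cong (λ z → q * suc z) (polynomial q) ⟩
      q * suc (threshold 6)                     ≡⟨ trans (ℕ.*-suc q (threshold 6)) (ℕ.+-comm q _) ⟩
      q * threshold 6 + q                       ≤⟨ ℕ.+-monoˡ-≤ q (ℕ.m≤m+n (q * threshold 6) (Q * degree W m)) ⟩
      q * threshold 6 + Q * degree W m + q      ≤⟨ large ⟩
      q * count (in? W)                         ≤⟨ ℕ.*-monoʳ-≤ q (count-≤n (in? W)) ⟩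
      q * b                                     ∎)) to
    where
    open ℕ.≤-Reasoning
    polynomial : ∀ z → z ^ 5 + z ^ 4 + z ^ 3 + z ^ 2 + z + 1 ≡ suc (z * suc (z * suc (z * suc (z * suc (z * suc (z * 0))))))
    polynomial = solve 1 (λ z → z :^ 5 :+ z :^ 4 :+ z :^ 3 :+ z :^ 2 :+ z :+ con 1 :=
        con 1 :+ z :* (con 1 :+ z :* (con 1 :+ z :* (con 1 :+ z :* (con 1 :+ z :* (con 1 :+ z :* con 0)))))) refl
      where open +-*-Solver

  -- A line has vector dimension 2, and each step adds 1. Since `t` = 6 is impossible, a closed
  -- subspace occurs at some `t` ≤ 5, in dimension at most 7.
  contained : b ≤ bound → ∀ s t → s + t ≡ 6 → (W : Subspace (2 + t)) → In W m → Large t W m →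
    ∃[ d ] (d ≤ 7 × Σ (Subspace d) λ S → ∀ i → In S i)
  contained to zero    .6 refl W mW large = ⊥-elim (too-large to W large)
  contained {m = m} to (suc s) t  eq   W mW large = continue (exit t W mW large)
    where
    continue : Closed W ⊎ ∃[ i ] ∃[ j ] (In W i × Leaves W i j × Large t W i) → ∃[ d ] (d ≤ 7 × Σ (Subspace d) λ S → ∀ i → In S i)
    continue (inj₁ closed) = 2 + t , s≤s (subst (suc t ≤_) eq (s≤s (ℕ.m≤n+m t s))) , W , closed-contains-all {i = m} to W closed mW
    continue (inj₂ (i , j , iW , (ij , j∉W) , large′)) =
      let (X , jX , large″) = large-step t W iW j∉W ij large′
      in contained to s (suc t) (trans (ℕ.+-suc s t) eq) X jX large″

  -- The start of the induction: a line contains no second line of the family, so its degree is 0,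
  -- and the line itself pays for the summand q.
  line-large : ∀ i → Large 0 (L i) i
  line-large i = begin
      q * 0 + Q * degree (L i) i + q    ≡⟨ cong (_+ q) (trans (cong (_+ Q * degree (L i) i) (ℕ.*-zeroʳ q)) (trans (cong (Q *_) degree≡0) (ℕ.*-zeroʳ Q))) ⟩
      q                                 ≡⟨ ℕ.*-identityʳ q ⟨
      q * 1                             ≤⟨ ℕ.*-monoʳ-≤ q (count-member (in? (L i)) i (⊆-refl (L i))) ⟩
      q * count (in? (L i))             ∎
    where
    open ℕ.≤-Reasoning
    degree≡0 : degree (L i) i ≡ 0
    degree≡0 = ℕ.n≤0⇒n≡0 (count-empty (λ j → in? (L i) j ×-dec concurrent? i j) λ j (j⊆i , i≢j , _) → ⊈-line (i≢j ∘ sym) j⊆i)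

  all-contained : Fin b → b ≤ bound → ContainedInDim≤ 𝓛 6
  all-contained i to =
    let (d , d≤7 , S , all) = contained to 6 0 refl (L i) (⊆-refl (L i)) (line-large i)
    in d , d≤7 , S , λ l l∈ → subst (_⊆ₛ S) (sym (lookup-index l∈)) (all (Any.index l∈))

theorem3 : ∀ {c ℓ : Level} (F : Field c ℓ) (q n : ℕ) → IsPrimePower q → HasOrder F q →
    (𝓛 : List (Geometry.Line F n)) → Geometry.LineSet F n 𝓛 → (∃[ l ] ∃[ ls ] (𝓛 ≡ l ∷ ls)) →
    Geometry.Conditions.Pt F n q 𝓛 → Geometry.Conditions.Pl F n q 𝓛 →
    Geometry.Conditions.Sd F n q 𝓛 → Geometry.Conditions.To F n q 𝓛 →
    Geometry.ContainedInDim≤ F n 𝓛 6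
-- The zero of the field needs an index, so `q` is positive; writing it as `suc Q` gives q - 1
-- without subtraction.
theorem3 F zero    n _ order _ _ _ _ _ _ _ = ⊥-elim (Fin.¬Fin0 (proj₁ (proj₂ (proj₂ order) (Field.0# F))))
theorem3 F (suc Q) n _ order 𝓛 distinct (l , ls , ≡.refl) pt pl sd to =
  Configuration.all-contained F Q n order (l ∷ ls) distinct pt pl sd fzero to
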